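{- Let $n \ge 1$ be an integer and let $\ell$ be the smallest integer such that $\ell \ge 4$ and $\ell \nmid n$. Then $s_n'((\mathbb{Z}/n\mathbb{Z})^2) = 4n - \ell + 1$.
   Context: A sequence over an abelian group $G$ is a finite sequence of elements of $G$ (repetition allowed); a subsequence is obtained by selecting some of its terms (not necessarily consecutive), and its length is the number of terms selected. A sequence is zero-sum if the sum of its terms is $0$. For a positive integer $k$, the modified Erdős–Ginzburg–Ziv constant $s_k'(G)$ is the smallest integer $L$ such that every zero-sum sequence over $G$ of length at least $L$ contains a zero-sum subsequence of length $k$. -}

module Defs where

open import Data.Nat using (ℕ; suc; _≤_; NonZero)
open import Data.Nat.DivMod using (_mod_)
open import Data.Fin using (Fin; toℕ)
open import Data.Product using (_×_; _,_; ∃-syntax)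
open import Data.List using (List; length; foldr)
open import Data.List.Relation.Binary.Sublist.Propositional using (_⊆_)
open import Relation.Binary.PropositionalEquality using (_≡_)
open import Relation.Nullary using (¬_)
import Data.Nat as ℕ

ZnSq : ℕ → Set
ZnSq n = Fin n × Fin n

_+ₙ_ : ∀ {n} .{{_ : NonZero n}} → Fin n → Fin n → Fin n
_+ₙ_ {n} a b = (toℕ a ℕ.+ toℕ b) mod n

zeroₙ : ∀ {n} .{{_ : NonZero n}} → Fin n
zeroₙ {n} = 0 mod n

_⊕_ : ∀ {n} .{{_ : NonZero n}} → ZnSq n → ZnSq n → ZnSq n
(a , b) ⊕ (c , d) = (a +ₙ c , b +ₙ d)

𝟘 : ∀ {n} .{{_ : NonZero n}} → ZnSq n
𝟘 = (zeroₙ , zeroₙ)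

σ : ∀ {n} .{{_ : NonZero n}} → List (ZnSq n) → ZnSq n
σ = foldr _⊕_ 𝟘

ZeroSum : ∀ {n} .{{_ : NonZero n}} → List (ZnSq n) → Set
ZeroSum S = σ S ≡ 𝟘

HasZeroSumSubseqOfLength : ∀ {n} .{{_ : NonZero n}} → ℕ → List (ZnSq n) → Set
HasZeroSumSubseqOfLength k S = ∃[ T ] (T ⊆ S × length T ≡ k × ZeroSum T)

SkProp : (n : ℕ) .{{_ : NonZero n}} → ℕ → ℕ → Set
SkProp n k L = ∀ (S : List (ZnSq n)) → ZeroSum S → L ≤ length S → HasZeroSumSubseqOfLength k S

SkPrimeEq : (n : ℕ) .{{_ : NonZero n}} → ℕ → ℕ → Set
SkPrimeEq n k L = SkProp n k L × (∀ L' → SkProp n k L' → L ≤ L')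

{-# OPTIONS --safe #-}
module Submission where

-- Lower bound: with multiplicities at most n − 1, the four points t, t + e₁, t + e₂, t + e₁ + e₂
-- admit no zero-sum subsequence of length n; since ℓ ∤ n, multiplicities adding up to 4n − ℓ and
-- a translation t can be chosen so that the whole sequence has sum zero.
--
-- Upper bound: lengths at least 4n − 3 are covered by Reiher's theorem s_n((ℤ/n)²) = 4n − 3.  The
-- remaining lengths are 4n − j with j ∣ n, say n = j r.  Reiher's theorem modulo j yields 4r − 4
-- disjoint blocks of length j with sum zero modulo j, and what is left has length 3j and sum zero
-- modulo j.  Such a sequence contains one more block, because any 3j − 2 terms have a zero-sum
-- subsequence of length j or 2j.  Reiher's theorem modulo r applies to the 4r − 3 blocks.
--
-- Both facts are multiplicative in the modulus.  For a prime p they follow from the vanishing of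
-- Σ (−1)^|A| f(σ A) over all subsequences A of a sequence longer than the degree of f, applied to
-- products f of rising factorials; Reiher's theorem also needs his double counting of pairs of
-- disjoint zero-sum subsequences of lengths p − 1 and 2p.

open import Defs
import Data.Nat as ℕ
open import Data.Nat using (zero; NonZero)
import Data.Nat.Properties as ℕ
import Data.Nat.Divisibility as ℕ∣
import Data.Nat.Tactic.RingSolver as ℕSolver
open import Data.Nat.DivMod
  using (_mod_; _/_; _%_; m%n<n; m%n%n≡m%n; m*n%n≡0; m≡m%n+[m/n]*n; %-distribˡ-+; m/n*n≡m; n/n≡1; m*n/n≡m)
open import Data.Nat.GCD using (gcd; gcd-GCD; gcd[m,n]∣m; gcd[m,n]∣n; module Bézout)
open import Data.Nat.ListAction using (product)
open import Data.Nat.Primality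
  using (Prime; euclidsLemma; prime⇒irreducible; prime⇒nonZero; productOfPrimes≢0; ¬prime[0]; ¬prime[1])
open import Data.Nat.Primality.Factorisation using (PrimeFactorisation; factorise)
open import Data.Empty using (⊥; ⊥-elim)
open import Data.Fin as F using (Fin; toℕ)
import Data.Fin.Properties as F
open import Data.Product using (_×_; _,_; proj₁; proj₂; ∃-syntax)
open import Data.Sum as Sum using (_⊎_; inj₁; inj₂)
open import Data.List using (List; []; _∷_; _++_; length; lookup; take; drop; concat; replicate)
open import Data.List.Properties using (length-++; take++drop≡id; length-take; length-drop; concat-++; length-replicate)
open import Data.List.Relation.Unary.All as All using (All; []; _∷_)
open import Data.List.Relation.Unary.All.Properties using (++⁻ˡ; ++⁻ʳ)
open import Data.List.Relation.Binary.Sublist.Propositional using (_⊆_; []; _∷ʳ_; _∷_)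
open import Data.List.Relation.Binary.Permutation.Propositional as ↭
  using (_↭_; ↭-refl; ↭-sym; ↭-trans; ↭-prep; ↭-reflexive)
open import Data.List.Relation.Binary.Permutation.Propositional.Properties
  using (shift; shifts; ++⁺ˡ; ++⁺ʳ; ++-comm; ++-assoc; ↭-length; ↭-empty-inv; All-resp-↭)
open import Relation.Binary.PropositionalEquality
  using (_≡_; _≢_; refl; sym; trans; cong; cong₂; subst; subst₂; module ≡-Reasoning)
open import Relation.Nullary using (Dec; yes; no; contradiction; map′; _×-dec_)
open import Relation.Unary using (Decidable)
open import Function using (_∘_; _⇔_; mk⇔; Equivalence)

-- Reiher's theorem modulo an odd p is a clash of two evaluations. Suppose that no p of the 4p - 3
-- terms have sum zero, and let N(k) count the zero-sum subsequences of length k. The double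
-- counting gives N(p - 1) ≡ N(3p - 1), whereas a degree argument gives N(p - 1) - N(3p - 1) ≡ 2
-- modulo p. The degree argument has to be blind to the lengths 2p - 1 and 2p, about which nothing
-- is known; this is what forces a computation modulo p². In the lower bound, translating by t moves
-- the sum of 4n - ℓ terms by (4n - ℓ)t, so modulo n it reaches only multiples of g = gcd(4n - ℓ,
-- n), a common divisor of n and ℓ. The bound n - 1 on the multiplicities leaves room for a
-- correction e with 2 ≤ e ≤ ℓ - 2, and e has to be a multiple of g. Since ℓ ∤ n makes g a proper
-- divisor of ℓ, such an e exists; if ℓ divided n, there would be none.

module PrimeModulus where

  open import Data.Nat using (ℕ; suc)
  open import Data.Nat.Divisibility using () renaming (_∣_ to _∣ℕ_)
  open import Data.Integer as ℤ using (ℤ; +_; 0ℤ; 1ℤ; -1ℤ; _+_; _*_; _-_; -_)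
  import Data.Integer.Properties as ℤ
  import Data.Integer.DivMod as ℤ
  open import Data.Integer.Divisibility.Signed as ℤ∣ using (divides) renaming (_∣_ to _∣ℤ_)
  open import Data.Integer.Tactic.RingSolver using (solve-∀)
  open import Relation.Nullary using (¬_)

  -- Finite differences

  -- The first two coordinates lift an element of the group, the third is a weight that specialises
  -- to the number of terms. Lifts to ℕ are used instead of residues so that the sum of a block can
  -- be divided by the modulus of the block.
  Point : Set
  Point = ℕ × ℕ × ℕ

  infixl 6 _∙_
  _∙_ : Point → Point → Point
  (a , b , c) ∙ (a′ , b′ , c′) = a ℕ.+ a′ , b ℕ.+ b′ , c ℕ.+ c′

  ∙-assoc : ∀ x y z → (x ∙ y) ∙ z ≡ x ∙ (y ∙ z)
  ∙-assoc (a , b , c) (a′ , b′ , c′) (a″ , b″ , c″) =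
    cong₂ _,_ (ℕ.+-assoc a a′ a″) (cong₂ _,_ (ℕ.+-assoc b b′ b″) (ℕ.+-assoc c c′ c″))

  ∙-comm : ∀ x y → x ∙ y ≡ y ∙ x
  ∙-comm (a , b , c) (a′ , b′ , c′) =
    cong₂ _,_ (ℕ.+-comm a a′) (cong₂ _,_ (ℕ.+-comm b b′) (ℕ.+-comm c c′))

  Δ : Point → (Point → ℤ) → Point → ℤ
  Δ g f x = f x - f (x ∙ g)

  -- D d f says that f is a polynomial of degree less than d.
  D : ℕ → (Point → ℤ) → Set
  D zero    f = ∀ x → f x ≡ 0ℤ
  D (suc d) f = ∀ g → D d (Δ g f)

  D-cong : ∀ d {f h} → (∀ x → f x ≡ h x) → D d f → D d h
  D-cong zero    f≗h Df x = trans (sym (f≗h x)) (Df x)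
  D-cong (suc d) f≗h Df g = D-cong d (λ x → cong₂ _-_ (f≗h x) (f≗h (x ∙ g))) (Df g)

  D-zero : ∀ d {f} → (∀ x → f x ≡ 0ℤ) → D d f
  D-zero zero    f≗0 = f≗0
  D-zero (suc d) f≗0 g = D-zero d (λ x → cong₂ _-_ (f≗0 x) (f≗0 (x ∙ g)))

  D-+ : ∀ d {f h} → D d f → D d h → D d (λ x → f x + h x)
  D-+ zero    Df Dh x = cong₂ _+_ (Df x) (Dh x)
  D-+ (suc d) {f} {h} Df Dh g =
    D-cong d (λ x → rearrange (f x) (f (x ∙ g)) (h x) (h (x ∙ g))) (D-+ d (Df g) (Dh g))
    where
    rearrange : ∀ a b c d → (a - b) + (c - d) ≡ (a + c) - (b + d)
    rearrange = solve-∀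

  D-shift : ∀ d {f} k → D d f → D d (λ x → f (x ∙ k))
  D-shift zero    k Df x = Df (x ∙ k)
  D-shift (suc d) {f} k Df g = D-cong d (λ x → cong (λ y → f (x ∙ k) - f y) (swap-last x)) (D-shift d k (Df g))
    where
    swap-last : ∀ x → x ∙ k ∙ g ≡ x ∙ g ∙ k
    swap-last x = trans (∙-assoc x k g) (trans (cong (x ∙_) (∙-comm k g)) (sym (∙-assoc x g k)))

  -- `D a` means degree at most a - 1, so the product has degree at most a + b - 2, which must be
  -- less than `c`. The induction uses Δ(f h) = Δf · h + f(· + g) · Δh; its second summand is why
  -- `D` has to be stable under shifts.
  D-* : ∀ {a b} c f h → D a f → D b h → a ℕ.+ b ℕ.≤ suc c → D c (λ x → f x * h x)
  D-* {zero} c f h Df Dh _ = D-zero c (λ x → cong (_* h x) (Df x))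
  D-* {suc a} {zero} c f h Df Dh _ = D-zero c (λ x → trans (cong (f x *_) (Dh x)) (ℤ.*-zeroʳ (f x)))
  D-* {suc a} {suc b} zero f h Df Dh (ℕ.s≤s a+b≤0) with ℕ.m+n≤o⇒n≤o a a+b≤0
  ... | ()
  D-* {suc a} {suc b} (suc c) f h Df Dh (ℕ.s≤s a+b≤c) g =
    D-cong c (λ x → leibniz (f x) (f (x ∙ g)) (h x) (h (x ∙ g)))
      (D-+ c (D-* {a} {suc b} c (Δ g f) h (Df g) Dh a+b≤c)
             (D-* {suc a} {b} c (λ x → f (x ∙ g)) (Δ g h) (D-shift (suc a) {f} g Df) (Dh g) (subst (ℕ._≤ suc c) (ℕ.+-suc a b) a+b≤c)))
    where
    leibniz : ∀ a b c d → (a - b) * c + b * (c - d) ≡ a * c - b * d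
    leibniz = solve-∀

  -- These products of consecutive integers take the place of the powers in a Chevalley-Warning
  -- argument: divisibility by p can be read off the individual factors.
  rise : ℤ → ℕ → ℤ
  rise y zero    = 1ℤ
  rise y (suc m) = y * rise (y + 1ℤ) m

  module _ (π : Point → ℕ) (π-∙ : ∀ x y → π (x ∙ y) ≡ π x ℕ.+ π y) where

    D-linear : ∀ z → D 2 (λ x → + π x + z)
    D-linear z g k x rewrite π-∙ x g | π-∙ (x ∙ k) g | π-∙ x k
      | ℤ.pos-+ (π x) (π g) | ℤ.pos-+ (π x ℕ.+ π k) (π g) | ℤ.pos-+ (π x) (π k) = cancel (+ π x) (+ π g) (+ π k) z
      where
      cancel : ∀ x g k z → (x + z - (x + g + z)) - (x + k + z - (x + k + g + z)) ≡ 0ℤ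
      cancel = solve-∀

    D-rise : ∀ m z → D (suc m) (λ x → rise (+ π x + z) m)
    D-rise zero    z g x = refl
    D-rise (suc m) z = D-* {2} {suc m} (suc (suc m)) (λ x → + π x + z) (λ x → rise (+ π x + z + 1ℤ) m) (D-linear z)
      (D-cong (suc m) {λ x → rise (+ π x + (z + 1ℤ)) m} (λ x → cong (λ y → rise y m) (sym (ℤ.+-assoc (+ π x) z 1ℤ))) (D-rise m (z + 1ℤ)))
      ℕ.≤-refl

  -- Sums over the splittings of a list into two parts

  module _ {E : Set} where

    -- Terms are distributed by position, so equal terms count as different. The complement is
    -- passed along because the double counting selects again among the terms outside `A`.
    splitSum : List E → (List E → List E → ℤ) → ℤ
    splitSum []       F = F [] []
    splitSum (e ∷ X) F = splitSum X (λ A B → F (e ∷ A) B) + splitSum X (λ A B → F A (e ∷ B))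

    splitSum-cong : ∀ X {F G} → (∀ A B → A ++ B ↭ X → F A B ≡ G A B) → splitSum X F ≡ splitSum X G
    splitSum-cong []       F≗G = F≗G [] [] ↭-refl
    splitSum-cong (e ∷ X) F≗G = cong₂ _+_
      (splitSum-cong X (λ A B p → F≗G (e ∷ A) B (↭-prep e p)))
      (splitSum-cong X (λ A B p → F≗G A (e ∷ B) (↭-trans (shift e A B) (↭-prep e p))))

    splitSum-+ : ∀ X F G → splitSum X (λ A B → F A B + G A B) ≡ splitSum X F + splitSum X G
    splitSum-+ []       F G = refl
    splitSum-+ (e ∷ X) F G = trans
      (cong₂ _+_ (splitSum-+ X (λ A B → F (e ∷ A) B) (λ A B → G (e ∷ A) B))
                 (splitSum-+ X (λ A B → F A (e ∷ B)) (λ A B → G A (e ∷ B))))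
      (interchange (splitSum X (λ A B → F (e ∷ A) B)) _ _ _)
      where
      interchange : ∀ a b c d → (a + b) + (c + d) ≡ (a + c) + (b + d)
      interchange = solve-∀

    splitSum-* : ∀ X z F → splitSum X (λ A B → z * F A B) ≡ z * splitSum X F
    splitSum-* []       z F = refl
    splitSum-* (e ∷ X) z F = trans
      (cong₂ _+_ (splitSum-* X z (λ A B → F (e ∷ A) B)) (splitSum-* X z (λ A B → F A (e ∷ B))))
      (sym (ℤ.*-distribˡ-+ z _ _))

    splitSum-∣ : ∀ X {m F} → (∀ A B → A ++ B ↭ X → m ∣ℤ F A B) → m ∣ℤ splitSum X F
    splitSum-∣ []       m∣F = m∣F [] [] ↭-refl
    splitSum-∣ (e ∷ X) m∣F = ℤ∣.∣m∣n⇒∣m+n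
      (splitSum-∣ X (λ A B p → m∣F (e ∷ A) B (↭-prep e p)))
      (splitSum-∣ X (λ A B p → m∣F A (e ∷ B) (↭-trans (shift e A B) (↭-prep e p))))

    -- Both sides run over all ordered partitions of X into three parts.
    splitSum-assoc : ∀ X (G : List E → List E → List E → ℤ) →
      splitSum X (λ A B → splitSum B (λ C R → G A C R)) ≡
      splitSum X (λ U R → splitSum U (λ C A → G A C R))
    splitSum-assoc []       G = refl
    splitSum-assoc (e ∷ X) G = begin
      splitSum X (λ A B → splitSum B (λ C R → G (e ∷ A) C R))
        + splitSum X (λ A B → splitSum B (λ C R → G A (e ∷ C) R) + splitSum B (λ C R → G A C (e ∷ R)))
        ≡⟨ cong₂ _+_ (splitSum-assoc X (λ A → G (e ∷ A)))
             (trans (splitSum-+ X _ _)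
               (cong₂ _+_ (splitSum-assoc X (λ A C → G A (e ∷ C))) (splitSum-assoc X (λ A C R → G A C (e ∷ R))))) ⟩
      a + (b + c)
        ≡⟨ rearrange a b c ⟩
      (b + a) + c
        ≡⟨ cong (_+ c) (splitSum-+ X _ _) ⟨
      splitSum (e ∷ X) (λ U R → splitSum U (λ C A → G A C R)) ∎
      where
      open ≡-Reasoning
      a = splitSum X (λ U R → splitSum U (λ C A → G (e ∷ A) C R))
      b = splitSum X (λ U R → splitSum U (λ C A → G A (e ∷ C) R))
      c = splitSum X (λ U R → splitSum U (λ C A → G A C (e ∷ R)))
      rearrange : ∀ a b c → a + (b + c) ≡ (b + a) + c
      rearrange = solve-∀

    sign : List E → ℤ
    sign []      = 1ℤ
    sign (_ ∷ A) = - sign A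

    module _ (pt : E → Point) where

      Σpt : List E → Point
      Σpt []      = 0 , 0 , 0
      Σpt (e ∷ A) = pt e ∙ Σpt A

      -- The alternating sum is the value of an iterated difference of f.
      alternating-sum : ∀ X f → D (length X) f → ∀ x → splitSum X (λ A _ → sign A * f (x ∙ Σpt A)) ≡ 0ℤ
      alternating-sum []       f Df x = trans (ℤ.*-identityˡ _) (Df _)
      alternating-sum (e ∷ X) f Df x = begin
        splitSum X (λ A _ → - sign A * f (x ∙ (pt e ∙ Σpt A))) + splitSum X (λ A _ → sign A * f (x ∙ Σpt A))
          ≡⟨ splitSum-+ X _ _ ⟨
        splitSum X (λ A _ → - sign A * f (x ∙ (pt e ∙ Σpt A)) + sign A * f (x ∙ Σpt A))
          ≡⟨ splitSum-cong X (λ A _ _ → trans (factor (sign A) _ _)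
               (cong (λ y → sign A * (f (x ∙ Σpt A) - f y))
                 (trans (cong (x ∙_) (∙-comm (pt e) (Σpt A))) (sym (∙-assoc x (Σpt A) (pt e)))))) ⟩
        splitSum X (λ A _ → sign A * Δ (pt e) f (x ∙ Σpt A))
          ≡⟨ alternating-sum X (Δ (pt e) f) (Df (pt e)) x ⟩
        0ℤ ∎
        where
        open ≡-Reasoning
        factor : ∀ s a b → - s * a + s * b ≡ s * (b - a)
        factor = solve-∀

  -- Rising factorials modulo a prime

  rise-last : ∀ y m → rise y (suc m) ≡ rise y m * (y + + m)
  rise-last y zero    = unit y
    where
    unit : ∀ y → y * 1ℤ ≡ 1ℤ * (y + 0ℤ)
    unit = solve-∀
  rise-last y (suc m) = begin
    y * rise (y + 1ℤ) (suc m)                  ≡⟨ cong (y *_) (rise-last (y + 1ℤ) m) ⟩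
    y * (rise (y + 1ℤ) m * (y + 1ℤ + + m))     ≡⟨ ℤ.*-assoc y _ _ ⟨
    y * rise (y + 1ℤ) m * (y + 1ℤ + + m)       ≡⟨ cong (y * rise (y + 1ℤ) m *_) (ℤ.+-assoc y 1ℤ (+ m)) ⟩
    y * rise (y + 1ℤ) m * (y + + suc m)        ∎
    where open ≡-Reasoning

  ∣-*-difference : ∀ {m} a b c d → m ∣ℤ a - b → m ∣ℤ c - d → m ∣ℤ a * c - b * d
  ∣-*-difference {m} a b c d m∣a-b m∣c-d =
    subst (m ∣ℤ_) (split a b c d) (ℤ∣.∣m∣n⇒∣m+n (ℤ∣.∣m⇒∣m*n c m∣a-b) (ℤ∣.∣n⇒∣m*n b m∣c-d))
    where
    split : ∀ a b c d → (a - b) * c + b * (c - d) ≡ a * c - b * d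
    split = solve-∀

  ∣-self-difference : ∀ {m} a → m ∣ℤ a - a
  ∣-self-difference {m} a = subst (m ∣ℤ_) (sym (ℤ.+-inverseʳ a)) (divides 0ℤ refl)

  ∣-*-∣ : ∀ {a b c d} → a ∣ℤ c → b ∣ℤ d → a * b ∣ℤ c * d
  ∣-*-∣ {a} {b} (divides x refl) (divides y refl) = divides (x * y) (interchange x a y b)
    where
    interchange : ∀ x a y b → x * a * (y * b) ≡ x * y * (a * b)
    interchange = solve-∀

  ∣-difference-trans : ∀ {m} x y z → m ∣ℤ x - y → m ∣ℤ y - z → m ∣ℤ x - z
  ∣-difference-trans {m} x y z m∣x-y m∣y-z = subst (m ∣ℤ_) (telescope x y z) (ℤ∣.∣m∣n⇒∣m+n m∣x-y m∣y-z)
    where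
    telescope : ∀ x y z → (x - y) + (y - z) ≡ x - z
    telescope = solve-∀

  rise-congruent : ∀ {p} y z m → p ∣ℤ y - z → p ∣ℤ rise y m - rise z m
  rise-congruent y z zero    p∣y-z = ∣-self-difference 1ℤ
  rise-congruent {p} y z (suc m) p∣y-z = ∣-*-difference y z _ _ p∣y-z
    (rise-congruent (y + 1ℤ) (z + 1ℤ) m (subst (p ∣ℤ_) (offset y z) p∣y-z))
    where
    offset : ∀ y z → y - z ≡ y + 1ℤ - (z + 1ℤ)
    offset = solve-∀

  rise-hit : ∀ {p} y m i → i ℕ.< m → p ∣ℤ y + + i → p ∣ℤ rise y m
  rise-hit {p} y (suc m) zero    _ p∣y = ℤ∣.∣m⇒∣m*n _ (subst (p ∣ℤ_) (ℤ.+-identityʳ y) p∣y)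
  rise-hit {p} y (suc m) (suc i) (ℕ.s≤s i<m) p∣y+i = ℤ∣.∣n⇒∣m*n y
    (rise-hit (y + 1ℤ) m i i<m (subst (p ∣ℤ_) (sym (ℤ.+-assoc y 1ℤ (+ i))) p∣y+i))

  p∣rise-p : ∀ p .{{_ : NonZero p}} y → + p ∣ℤ rise y p
  -- Among the p consecutive integers starting at y, the multiple of p is y + (-y mod p).
  p∣rise-p p y = rise-hit y p (- y ℤ.%ℕ p) (ℤ.n%ℕd<d (- y) p)
    (divides (- (- y ℤ./ℕ p)) (cancel y r q (+ p) (ℤ.a≡a%ℕn+[a/ℕn]*n (- y) p)))
    where
    r = + (- y ℤ.%ℕ p)
    q = - y ℤ./ℕ p
    lemma : ∀ r q p → - (r + q * p) + r ≡ - q * p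
    lemma = solve-∀
    cancel : ∀ y r q p → - y ≡ r + q * p → y + r ≡ - q * p
    cancel y r q p -y≡ = trans (cong (_+ r) (trans (sym (ℤ.neg-involutive y)) (cong -_ -y≡))) (lemma r q p)

  euclidℤ : ∀ {p} → Prime p → ∀ a b → + p ∣ℤ a * b → + p ∣ℤ a ⊎ + p ∣ℤ b
  euclidℤ {p} pr a b p∣ab = Sum.map ℤ∣.∣ᵤ⇒∣ ℤ∣.∣ᵤ⇒∣
    (euclidsLemma ℤ.∣ a ∣ ℤ.∣ b ∣ pr (subst (p ∣ℕ_) (ℤ.abs-* a b) (ℤ∣.∣⇒∣ᵤ p∣ab)))

  ∣ℕ⇒∣ℤ : ∀ {m n} → m ∣ℕ n → + m ∣ℤ + n
  ∣ℕ⇒∣ℤ = ℤ∣.∣ᵤ⇒∣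

  ∣ℤ⇒∣ℕ : ∀ {m n} → + m ∣ℤ + n → m ∣ℕ n
  ∣ℤ⇒∣ℕ = ℤ∣.∣⇒∣ᵤ

  p∤1 : ∀ {p} → Prime p → ¬ (+ p ∣ℤ 1ℤ)
  p∤1 {p} pr p∣1 = ¬prime[1] (subst Prime (ℕ∣.∣1⇒≡1 (∣ℤ⇒∣ℕ p∣1)) pr)

  -- All factors lie between a + 1 and a + m, hence strictly between 0 and p.
  rise-unit : ∀ {p} → Prime p → ∀ a m → a ℕ.+ m ℕ.< p → ¬ (+ p ∣ℤ rise (+ suc a) m)
  rise-unit pr a zero    a+m<p p∣ = p∤1 pr p∣
  rise-unit {p} pr a (suc m) a+m<p p∣ with euclidℤ pr (+ suc a) _ p∣
  ... | inj₁ p∣suc-a = ℕ.<⇒≱ (ℕ.≤-<-trans (ℕ.m≤m+n (suc a) m) (subst (ℕ._< p) (ℕ.+-suc a m) a+m<p)) (ℕ∣.∣⇒≤ (∣ℤ⇒∣ℕ p∣suc-a))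
  ... | inj₂ p∣rest = rise-unit pr (suc a) m (subst (ℕ._< p) (ℕ.+-suc a m) a+m<p)
    (subst (λ y → + p ∣ℤ rise y m) (cong +_ (ℕ.+-comm (suc a) 1)) p∣rest)

  module _ (q : ℕ) (pr : Prime (suc (suc q))) where

    private
      p : ℕ
      p = suc (suc q)

    -- This is (p - 1)!; `c′` below is (p - 2)!.
    c : ℤ
    c = rise 1ℤ (suc q)

    p∤c : ¬ (+ p ∣ℤ c)
    p∤c = rise-unit pr 0 (suc q) (ℕ.n<1+n (suc q))

    -- Up to the factor c, the indicator of the multiples of p.
    h : ℕ → ℤ
    h a = rise (+ a + 1ℤ) (suc q)

    h-congruent : ∀ a → p ∣ℕ a → + p ∣ℤ h a - c
    h-congruent a p∣a = rise-congruent (+ a + 1ℤ) 1ℤ (suc q) (subst (+ p ∣ℤ_) (cancel (+ a)) (∣ℕ⇒∣ℤ p∣a))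
      where
      cancel : ∀ a → a ≡ a + 1ℤ - 1ℤ
      cancel = solve-∀

    h-vanishes : ∀ a → ¬ (p ∣ℕ a) → + p ∣ℤ h a
    h-vanishes a p∤a with euclidℤ pr (+ a) (h a) (p∣rise-p p (+ a))
    ... | inj₁ p∣a = contradiction (∣ℤ⇒∣ℕ p∣a) p∤a
    ... | inj₂ p∣h = p∣h

    -- Q is divisible by p, and Q k / p is, up to a unit modulo p, equal to j − 2 for k = j p, to 2 − j
    -- for k = j p − 1, and zero otherwise.  A polynomial over 𝔽_p is p-periodic and cannot see j,
    -- hence the computation modulo p².
    narrow wide Q : ℕ → ℤ
    narrow k = rise (+ k + + 2) q
    wide k = rise (+ k + (- + (2 ℕ.* p))) p
    Q k = narrow k * wide k

    p∣wide : ∀ k → + p ∣ℤ wide k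
    p∣wide k = p∣rise-p p (+ k + (- + (2 ℕ.* p)))

    p∣Q : ∀ k → + p ∣ℤ Q k
    p∣Q k = ℤ∣.∣n⇒∣m*n (narrow k) (p∣wide k)

    -- Among k, ..., k + p - 1 some factor is divisible by p. If it is neither k nor k + 1, it is a
    -- factor of `narrow k`; `wide k` always supplies the second p.
    Q-vanishes : ∀ k → ¬ (p ∣ℕ k) → ¬ (p ∣ℕ suc k) → + p * + p ∣ℤ Q k
    Q-vanishes k p∤k p∤sk = ∣-*-∣ p∣narrow (p∣wide k)
      where
      p∣narrow : + p ∣ℤ narrow k
      p∣narrow with euclidℤ pr (+ k) _ (p∣rise-p p (+ k))
      ... | inj₁ p∣k = contradiction (∣ℤ⇒∣ℕ p∣k) p∤k
      ... | inj₂ p∣rest with euclidℤ pr (+ k + 1ℤ) _ p∣rest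
      ...   | inj₁ p∣k+1 = contradiction (∣ℤ⇒∣ℕ (subst (λ y → + p ∣ℤ + y) (ℕ.+-comm k 1) p∣k+1)) p∤sk
      ...   | inj₂ p∣tail = subst (λ y → + p ∣ℤ rise y q) (ℤ.+-assoc (+ k) 1ℤ 1ℤ) p∣tail

    c′ : ℤ
    c′ = rise 1ℤ q

    c≡c′*[p-1] : c ≡ c′ * (+ p - 1ℤ)
    c≡c′*[p-1] = rise-last 1ℤ q

    narrow-0 : ∀ k → p ∣ℕ k → + p ∣ℤ narrow k - c
    narrow-0 k p∣k = subst (λ z → + p ∣ℤ narrow k - z) (sym (ℤ.*-identityˡ _))
      (rise-congruent (+ k + + 2) (+ 2) q (subst (+ p ∣ℤ_) (cancel (+ k)) (∣ℕ⇒∣ℤ p∣k)))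
      where
      cancel : ∀ a → a ≡ a + + 2 - + 2
      cancel = solve-∀

    c′≈-c : + p ∣ℤ c′ - - c
    c′≈-c = divides c′ (trans (cong (λ z → c′ - - z) c≡c′*[p-1]) (collect c′ (+ p)))
      where
      collect : ∀ c p → c - - (c * (p - 1ℤ)) ≡ c * p
      collect = solve-∀

    narrow--1 : ∀ k → p ∣ℕ suc k → + p ∣ℤ narrow k - - c
    narrow--1 k p∣sk = ∣-difference-trans (narrow k) c′ (- c)
      (rise-congruent (+ k + + 2) 1ℤ q (subst (+ p ∣ℤ_) (cancel (+ k)) (∣ℕ⇒∣ℤ p∣sk))) c′≈-c
      where
      cancel : ∀ k → 1ℤ + k ≡ k + + 2 - 1ℤ
      cancel = solve-∀

    -- With j = k / p or (k + 1) / p, the factor of wide k divisible by p is (j - 2) p.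
    wide-0 : ∀ k j → k ≡ j ℕ.* p → + p * + p ∣ℤ wide k - + p * ((+ j - + 2) * c)
    wide-0 k j refl = subst (+ p * + p ∣ℤ_) (sym eq)
      (∣-*-∣ (ℤ∣.∣-refl {+ p}) (ℤ∣.∣n⇒∣m*n (+ j - + 2) rest))
      where
      y = + (j ℕ.* p) + (- + (2 ℕ.* p))
      y≡ : y ≡ + p * (+ j - + 2)
      y≡ = trans (cong₂ (λ a b → a - b) (ℤ.pos-* j p) (ℤ.pos-* 2 p)) (factor (+ j) (+ p))
        where
        factor : ∀ j p → j * p - + 2 * p ≡ p * (j - + 2)
        factor = solve-∀
      rest : + p ∣ℤ rise (y + 1ℤ) (suc q) - c
      rest = rise-congruent (y + 1ℤ) 1ℤ (suc q)
        (divides (+ j - + 2) (trans (cong (λ z → z + 1ℤ - 1ℤ) y≡) (commute (+ j) (+ p))))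
        where
        commute : ∀ j p → p * (j - + 2) + 1ℤ - 1ℤ ≡ (j - + 2) * p
        commute = solve-∀
      eq : y * rise (y + 1ℤ) (suc q) - + p * ((+ j - + 2) * c) ≡ + p * ((+ j - + 2) * (rise (y + 1ℤ) (suc q) - c))
      eq = trans (cong (λ z → z * rise (y + 1ℤ) (suc q) - + p * ((+ j - + 2) * c)) y≡)
        (collect (+ p) (+ j - + 2) _ c)
        where
        collect : ∀ p t r c → p * t * r - p * (t * c) ≡ p * (t * (r - c))
        collect = solve-∀

    wide--1 : ∀ k j → suc k ≡ j ℕ.* p → + p * + p ∣ℤ wide k - + p * ((+ j - + 2) * c)
    wide--1 k j sk≡ = subst (+ p * + p ∣ℤ_) (sym eq)
      (∣-*-∣ (ℤ∣.∣-refl {+ p}) (ℤ∣.∣n⇒∣m*n (+ j - + 2) rest))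
      where
      y = + k + (- + (2 ℕ.* p))
      k≡ : + k ≡ + j * + p - 1ℤ
      k≡ = trans (pred (+ k)) (trans (cong (λ z → z - 1ℤ) (cong +_ sk≡)) (cong (λ z → z - 1ℤ) (ℤ.pos-* j p)))
        where
        pred : ∀ k → k ≡ 1ℤ + k - 1ℤ
        pred = solve-∀
      y≡ : y ≡ + p * (+ j - + 2) - 1ℤ
      y≡ = trans (cong₂ (λ a b → a - b) k≡ (ℤ.pos-* 2 p)) (factor (+ j) (+ p))
        where
        factor : ∀ j p → j * p - 1ℤ - + 2 * p ≡ p * (j - + 2) - 1ℤ
        factor = solve-∀
      tail : ℤ
      tail = rise (y + 1ℤ + 1ℤ) q
      -- Here y ≡ -1 precedes the factor (j - 2)p, and the q factors after it are congruent to 1,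
      -- ..., p - 2. The product is -(p - 2)! ≡ (p - 1)!.
      rest : + p ∣ℤ y * tail - c
      rest = subst (λ z → + p ∣ℤ y * tail - z) (minus-minus c)
        (∣-*-difference y -1ℤ tail (- c)
          (divides (+ j - + 2) (trans (cong (λ z → z - -1ℤ) y≡) (cancel (+ j) (+ p))))
          (∣-difference-trans tail c′ (- c)
            (rise-congruent _ 1ℤ q (divides (+ j - + 2) (trans (cong (λ z → z + 1ℤ + 1ℤ - 1ℤ) y≡) (cancel′ (+ j) (+ p)))))
            c′≈-c))
        where
        minus-minus : ∀ c → -1ℤ * - c ≡ c
        minus-minus = solve-∀
        cancel : ∀ j p → p * (j - + 2) - 1ℤ - -1ℤ ≡ (j - + 2) * p
        cancel = solve-∀
        cancel′ : ∀ j p → p * (j - + 2) - 1ℤ + 1ℤ + 1ℤ - 1ℤ ≡ (j - + 2) * p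
        cancel′ = solve-∀
      eq : y * ((y + 1ℤ) * tail) - + p * ((+ j - + 2) * c) ≡ + p * ((+ j - + 2) * (y * tail - c))
      eq = trans (cong (λ z → y * (z * tail) - + p * ((+ j - + 2) * c)) (trans (cong (_+ 1ℤ) y≡) (back (+ j) (+ p))))
        (collect (+ p) (+ j - + 2) tail y c)
        where
        back : ∀ j p → p * (j - + 2) - 1ℤ + 1ℤ ≡ p * (j - + 2)
        back = solve-∀
        collect : ∀ p t r y c → y * (p * t * r) - p * (t * c) ≡ p * (t * (y * r - c))
        collect = solve-∀

    -- Since `y` already contributes a factor p, it is enough to know `x` modulo p in order to know
    -- the product modulo p².
    square-difference : ∀ x x′ y y′ → + p ∣ℤ x - x′ → + p ∣ℤ y → + p * + p ∣ℤ y - y′ → + p * + p ∣ℤ x * y - x′ * y′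
    square-difference x x′ y y′ p∣x-x′ p∣y p²∣y-y′ = subst (+ p * + p ∣ℤ_) (split x x′ y y′)
      (ℤ∣.∣m∣n⇒∣m+n (∣-*-∣ p∣x-x′ p∣y) (ℤ∣.∣n⇒∣m*n x′ p²∣y-y′))
      where
      split : ∀ x x′ y y′ → (x - x′) * y + x′ * (y - y′) ≡ x * y - x′ * y′
      split = solve-∀

    H : ℕ → ℕ → ℕ → ℤ
    H a b k = h a * h b * Q k

    H-nonzero-sum : ∀ a b k → ¬ (p ∣ℕ a × p ∣ℕ b) → + p * + p ∣ℤ H a b k
    H-nonzero-sum a b k p∤ = ∣-*-∣ p∣hh (p∣Q k)
      where
      p∣hh : + p ∣ℤ h a * h b
      p∣hh with p ℕ∣.∣? a | p ℕ∣.∣? b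
      ... | no p∤a | _ = ℤ∣.∣m⇒∣m*n (h b) (h-vanishes a p∤a)
      ... | yes _ | no p∤b = ℤ∣.∣n⇒∣m*n (h a) (h-vanishes b p∤b)
      ... | yes p∣a | yes p∣b = contradiction (p∣a , p∣b) p∤

    H-other : ∀ a b k → ¬ (p ∣ℕ k) → ¬ (p ∣ℕ suc k) → + p * + p ∣ℤ H a b k
    H-other a b k p∤k p∤sk = ℤ∣.∣n⇒∣m*n (h a * h b) (Q-vanishes k p∤k p∤sk)

    -- One factor `c` comes from each of the two `h`, one from `narrow` and one from `wide`.
    C : ℤ
    C = c * c * (c * c)

    H-value : ∀ a b k j s → p ∣ℕ a → p ∣ℕ b → + p ∣ℤ narrow k - s * c →
              + p * + p ∣ℤ wide k - + p * ((+ j - + 2) * c) →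
              + p * + p ∣ℤ H a b k - + p * C * (s * (+ j - + 2))
    H-value a b k j s p∣a p∣b p∣n p²∣w = subst (λ z → + p * + p ∣ℤ H a b k - z) (collect c s (+ p) (+ j - + 2))
      (square-difference (h a * h b) (c * c) (Q k) _
        (∣-*-difference (h a) c (h b) c (h-congruent a p∣a) (h-congruent b p∣b)) (p∣Q k)
        (square-difference (narrow k) (s * c) (wide k) _ p∣n (p∣wide k) p²∣w))
      where
      collect : ∀ c s p t → c * c * (s * c * (p * (t * c))) ≡ p * (c * c * (c * c)) * (s * t)
      collect = solve-∀

    H-0 : ∀ a b k j → p ∣ℕ a → p ∣ℕ b → k ≡ j ℕ.* p → + p * + p ∣ℤ H a b k - + p * C * (+ j - + 2)
    H-0 a b k j p∣a p∣b k≡ = subst (λ z → + p * + p ∣ℤ H a b k - + p * C * z) (ℤ.*-identityˡ _)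
      (H-value a b k j 1ℤ p∣a p∣b
        (subst (λ z → + p ∣ℤ narrow k - z) (sym (ℤ.*-identityˡ c)) (narrow-0 k (ℕ∣.divides j k≡)))
        (wide-0 k j k≡))

    H--1 : ∀ a b k j → p ∣ℕ a → p ∣ℕ b → suc k ≡ j ℕ.* p → + p * + p ∣ℤ H a b k - + p * C * (- (+ j - + 2))
    H--1 a b k j p∣a p∣b sk≡ = subst (λ z → + p * + p ∣ℤ H a b k - + p * C * z) (ℤ.-1*i≡-i _)
      (H-value a b k j -1ℤ p∣a p∣b
        (subst (λ z → + p ∣ℤ narrow k - z) (sym (ℤ.-1*i≡-i c)) (narrow--1 k (ℕ∣.divides j sk≡)))
        (wide--1 k j sk≡))

  -- Zero-sum subsequences

  ZS : ℕ → Point → Set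
  ZS n (a , b , _) = n ∣ℕ a × n ∣ℕ b

  zs? : ∀ n s → Dec (ZS n s)
  zs? n (a , b , _) = (n ℕ∣.∣? a) ×-dec (n ℕ∣.∣? b)

  weight : Point → ℕ
  weight (_ , _ , w) = w

  ZS-∙ : ∀ {n} s t → ZS n s → ZS n t → ZS n (s ∙ t)
  ZS-∙ s t (x , y) (x′ , y′) = ℕ∣.∣m∣n⇒∣m+n x x′ , ℕ∣.∣m∣n⇒∣m+n y y′

  ZS-cancelˡ : ∀ {n} s t → ZS n (s ∙ t) → ZS n s → ZS n t
  ZS-cancelˡ s t (x , y) (x′ , y′) = ℕ∣.∣m+n∣m⇒∣n x x′ , ℕ∣.∣m+n∣m⇒∣n y y′

  module _ {E : Set} where

    -- The remaining terms `R` are part of the data: blocks are removed one after another, and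
    -- complements of zero-sum subsequences are used again.
    Select : (List E → Set) → List E → Set
    Select P X = ∃[ T ] ∃[ R ] (T ++ R ↭ X × P T)

    ⊆⇒↭ : ∀ {T X : List E} → T ⊆ X → ∃[ R ] (T ++ R ↭ X)
    ⊆⇒↭ [] = [] , ↭-refl
    ⊆⇒↭ {T} (y ∷ʳ τ) = let R , T++R↭X = ⊆⇒↭ τ in y ∷ R , ↭-trans (shift y T R) (↭-prep y T++R↭X)
    ⊆⇒↭ (refl ∷ τ) = let R , T++R↭X = ⊆⇒↭ τ in R , ↭-prep _ T++R↭X

    ⊆-↭ : ∀ {T Y X : List E} → Y ↭ X → T ⊆ Y → ∃[ T′ ] (T′ ⊆ X × T′ ↭ T)
    ⊆-↭ ↭.refl τ = _ , τ , ↭-refl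
    ⊆-↭ (↭.prep x p) (.x ∷ʳ τ) = let T′ , τ′ , T′↭T = ⊆-↭ p τ in T′ , x ∷ʳ τ′ , T′↭T
    ⊆-↭ (↭.prep x p) (refl ∷ τ) = let T′ , τ′ , T′↭T = ⊆-↭ p τ in x ∷ T′ , refl ∷ τ′ , ↭-prep x T′↭T
    ⊆-↭ (↭.swap x y p) (.x ∷ʳ .y ∷ʳ τ) = let T′ , τ′ , T′↭T = ⊆-↭ p τ in T′ , y ∷ʳ x ∷ʳ τ′ , T′↭T
    ⊆-↭ (↭.swap x y p) (.x ∷ʳ refl ∷ τ) = let T′ , τ′ , T′↭T = ⊆-↭ p τ in y ∷ T′ , refl ∷ x ∷ʳ τ′ , ↭-prep y T′↭T
    ⊆-↭ (↭.swap x y p) (refl ∷ .y ∷ʳ τ) = let T′ , τ′ , T′↭T = ⊆-↭ p τ in x ∷ T′ , y ∷ʳ refl ∷ τ′ , ↭-prep x T′↭T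
    ⊆-↭ (↭.swap x y p) (refl ∷ refl ∷ τ) = let T′ , τ′ , T′↭T = ⊆-↭ p τ in y ∷ x ∷ T′ , refl ∷ refl ∷ τ′ , ↭.swap y x T′↭T
    ⊆-↭ (↭.trans p r) τ =
      let T′ , τ′ , T′↭T = ⊆-↭ p τ
          T″ , τ″ , T″↭T′ = ⊆-↭ r τ′
      in T″ , τ″ , ↭-trans T″↭T′ T′↭T

    ⊆-++ : ∀ (T R : List E) → T ⊆ T ++ R
    ⊆-++ []      []      = []
    ⊆-++ []      (x ∷ R) = x ∷ʳ ⊆-++ [] R
    ⊆-++ (x ∷ T) R       = refl ∷ ⊆-++ T R

    ↭⇒⊆ : ∀ {T R X : List E} → T ++ R ↭ X → ∃[ T′ ] (T′ ⊆ X × T′ ↭ T)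
    ↭⇒⊆ {T} {R} p = ⊆-↭ p (⊆-++ T R)

    sublist? : ∀ {P : List E → Set} → Decidable P → ∀ X → Dec (∃[ T ] (T ⊆ X × P T))
    sublist? P? [] = map′ (λ P[] → [] , [] , P[]) (λ { (_ , [] , P[]) → P[] }) (P? [])
    sublist? {P} P? (x ∷ X) with sublist? P? X | sublist? {λ T → P (x ∷ T)} (λ T → P? (x ∷ T)) X
    ... | yes (T , τ , PT) | _ = yes (T , x ∷ʳ τ , PT)
    ... | no _ | yes (T , τ , PT) = yes (x ∷ T , refl ∷ τ , PT)
    ... | no ¬without | no ¬with = no λ where
      (T , .x ∷ʳ τ , PT) → ¬without (T , τ , PT)
      (_ , refl ∷ τ , PT) → ¬with (_ , τ , PT)

    -- The degree arguments only refute the absence of a subsequence; an exhaustive search turns the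
    -- refutation into a witness.
    select? : ∀ {P : List E → Set} → Decidable P → (∀ {T T′} → T ↭ T′ → P T → P T′) →
              ∀ X → Dec (Select P X)
    select? P? resp X = map′
      (λ { (T , τ , PT) → let R , p = ⊆⇒↭ τ in T , R , p , PT })
      (λ { (T , R , p , PT) → let T′ , τ , T′↭T = ↭⇒⊆ {T} {R} p in T′ , τ , resp (↭-sym T′↭T) PT })
      (sublist? P? X)

    Select-within : ∀ {P X} Y Z → Y ++ Z ↭ X → Select P Y → Select P X
    Select-within Y Z p (T , R , r , PT) =
      T , R ++ Z , ↭-trans (↭-sym (++-assoc T R Z)) (↭-trans (++⁺ʳ Z r) p) , PT

    module _ (v : E → Point) where

      Σpt-↭ : ∀ {A B} → A ↭ B → Σpt v A ≡ Σpt v B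
      Σpt-↭ ↭.refl = refl
      Σpt-↭ (↭.prep x p) = cong (v x ∙_) (Σpt-↭ p)
      Σpt-↭ (↭.swap {ys = ys} x y p) = trans (cong (λ s → v x ∙ (v y ∙ s)) (Σpt-↭ p))
        (trans (sym (∙-assoc (v x) (v y) (Σpt v ys)))
          (trans (cong (_∙ Σpt v ys) (∙-comm (v x) (v y))) (∙-assoc (v y) (v x) (Σpt v ys))))
      Σpt-↭ (↭.trans p r) = trans (Σpt-↭ p) (Σpt-↭ r)

      Σpt-++ : ∀ A B → Σpt v (A ++ B) ≡ Σpt v A ∙ Σpt v B
      Σpt-++ []      B = refl
      Σpt-++ (x ∷ A) B = trans (cong (v x ∙_) (Σpt-++ A B)) (sym (∙-assoc (v x) (Σpt v A) (Σpt v B)))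

      Σpt-split : ∀ A B {X} → A ++ B ↭ X → Σpt v X ≡ Σpt v A ∙ Σpt v B
      Σpt-split A B p = trans (Σpt-↭ (↭-sym p)) (Σpt-++ A B)

    length-split : ∀ (A B {X} : List E) → A ++ B ↭ X → length A ℕ.+ length B ≡ length X
    length-split A B p = trans (sym (length-++ A)) (↭-length p)

    splitSum-zero : ∀ (X : List E) → splitSum X (λ _ _ → 0ℤ) ≡ 0ℤ
    splitSum-zero []      = refl
    splitSum-zero (x ∷ X) = cong₂ _+_ (splitSum-zero X) (splitSum-zero X)

    splitSum-congruent : ∀ (X : List E) {m} F G → (∀ A B → A ++ B ↭ X → m ∣ℤ F A B - G A B) →
                         m ∣ℤ splitSum X F - splitSum X G
    splitSum-congruent X {m} F G F≈G = subst (m ∣ℤ_)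
      (trans (splitSum-+ X F (λ A B → - G A B))
        (cong (λ z → splitSum X F + z)
          (trans (splitSum-cong X (λ A B _ → sym (ℤ.-1*i≡-i (G A B))))
            (trans (splitSum-* X -1ℤ G) (ℤ.-1*i≡-i _)))))
      (splitSum-∣ X {F = λ A B → F A B - G A B} F≈G)

    empty : List E → ℤ
    empty []      = 1ℤ
    empty (_ ∷ _) = 0ℤ

    splitSum-empty : ∀ X → splitSum X (λ A _ → empty A) ≡ 1ℤ
    splitSum-empty []      = refl
    splitSum-empty (x ∷ X) = cong₂ _+_ (splitSum-zero X) (splitSum-empty X)

  𝟙 : ∀ {P : Set} → Dec P → ℤ
  𝟙 (yes _) = 1ℤ
  𝟙 (no  _) = 0ℤ

  𝟙-yes : ∀ {P : Set} (P? : Dec P) → P → 𝟙 P? ≡ 1ℤ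
  𝟙-yes (yes _) p = refl
  𝟙-yes (no ¬p) p = contradiction p ¬p

  𝟙-no : ∀ {P : Set} (P? : Dec P) → ¬ P → 𝟙 P? ≡ 0ℤ
  𝟙-no (yes p) ¬p = contradiction p ¬p
  𝟙-no (no  _) ¬p = refl

  sign-parity : ∀ {E : Set} (A : List E) → (sign A ≡ 1ℤ × 2 ∣ℕ length A) ⊎ (sign A ≡ -1ℤ × 2 ∣ℕ suc (length A))
  sign-parity [] = inj₁ (refl , ℕ∣.divides 0 refl)
  sign-parity (x ∷ A) with sign-parity A
  ... | inj₁ (s , 2∣k) = inj₂ (cong -_ s , ℕ∣.∣m∣n⇒∣m+n (ℕ∣.∣-refl {2}) 2∣k)
  ... | inj₂ (s , 2∣sk) = inj₁ (cong -_ s , 2∣sk)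

  private
    not-consecutive : ∀ k → 2 ∣ℕ k → ¬ (2 ∣ℕ suc k)
    not-consecutive k 2∣k 2∣sk = contradiction (ℕ∣.∣1⇒≡1 (ℕ∣.∣m+n∣m⇒∣n {m = k} (subst (2 ∣ℕ_) (ℕ.+-comm 1 k) 2∣sk) 2∣k)) λ ()

  sign-even : ∀ {E : Set} (A : List E) → 2 ∣ℕ length A → sign A ≡ 1ℤ
  sign-even A 2∣k with sign-parity A
  ... | inj₁ (s , _) = s
  ... | inj₂ (_ , 2∣sk) = contradiction 2∣sk (not-consecutive _ 2∣k)

  -- The degree argument modulo a prime

  module PrimeCase (q : ℕ) (pr : Prime (suc (suc q))) {E : Set} (v : E → Point) where

    private
      p : ℕ
      p = suc (suc q)
      c₀ = c q pr
      h₀ = h q pr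

    -- A polynomial of degree 3(p - 1) that is nonzero modulo p exactly where p divides all three
    -- coordinates.
    hhh : Point → ℤ
    hhh (a , b , w) = h₀ a * h₀ b * h₀ w

    D-h : ∀ (π : Point → ℕ) → (∀ x y → π (x ∙ y) ≡ π x ℕ.+ π y) → D p (λ x → h₀ (π x))
    D-h π π-∙ = D-rise π π-∙ (suc q) 1ℤ

    D-hh : D (3 ℕ.+ 2 ℕ.* q) (λ x → h₀ (proj₁ x) * h₀ (proj₁ (proj₂ x)))
    D-hh = D-* {p} {p} (3 ℕ.+ 2 ℕ.* q) (λ x → h₀ (proj₁ x)) (λ x → h₀ (proj₁ (proj₂ x)))
      (D-h proj₁ (λ _ _ → refl)) (D-h (proj₁ ∘ proj₂) (λ _ _ → refl)) (ℕ.≤-reflexive (bound q))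
      where
      bound : ∀ q → (2 ℕ.+ q) ℕ.+ (2 ℕ.+ q) ≡ 1 ℕ.+ (3 ℕ.+ 2 ℕ.* q)
      bound = ℕSolver.solve-∀

    D-hhh : ∀ d → 3 ℕ.* suc q ℕ.< d → D d hhh
    D-hhh d 3[p-1]<d = D-* {3 ℕ.+ 2 ℕ.* q} {p} d (λ x → h₀ (proj₁ x) * h₀ (proj₁ (proj₂ x))) (λ x → h₀ (weight x))
      D-hh (D-h weight (λ _ _ → refl)) (ℕ.≤-trans (ℕ.≤-reflexive (bound q)) (ℕ.s≤s 3[p-1]<d))
      where
      bound : ∀ q → (3 ℕ.+ 2 ℕ.* q) ℕ.+ (2 ℕ.+ q) ≡ 2 ℕ.+ 3 ℕ.* (1 ℕ.+ q)
      bound = ℕSolver.solve-∀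

    Divisible : Point → Set
    Divisible s = ZS p s × p ∣ℕ weight s

    hhh-vanishes : ∀ s → ¬ Divisible s → + p ∣ℤ hhh s
    hhh-vanishes (a , b , w) ¬div with p ℕ∣.∣? a | p ℕ∣.∣? b | p ℕ∣.∣? w
    ... | no p∤a | _ | _ = ℤ∣.∣m⇒∣m*n (h₀ w) (ℤ∣.∣m⇒∣m*n (h₀ b) (h-vanishes q pr a p∤a))
    ... | yes _ | no p∤b | _ = ℤ∣.∣m⇒∣m*n (h₀ w) (ℤ∣.∣n⇒∣m*n (h₀ a) (h-vanishes q pr b p∤b))
    ... | yes _ | yes _ | no p∤w = ℤ∣.∣n⇒∣m*n (h₀ a * h₀ b) (h-vanishes q pr w p∤w)
    ... | yes x | yes y | yes z = contradiction ((x , y) , z) ¬div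

    c³ : ℤ
    c³ = c₀ * c₀ * c₀

    hhh-congruent : ∀ s → Divisible s → + p ∣ℤ hhh s - c³
    hhh-congruent (a , b , w) ((x , y) , z) =
      ∣-*-difference (h₀ a * h₀ b) (c₀ * c₀) (h₀ w) c₀
        (∣-*-difference (h₀ a) c₀ (h₀ b) c₀ (h-congruent q pr a x) (h-congruent q pr b y)) (h-congruent q pr w z)

    cancel-c : ∀ z → + p ∣ℤ c₀ * z → + p ∣ℤ z
    cancel-c z p∣cz with euclidℤ pr c₀ z p∣cz
    ... | inj₁ p∣c = contradiction p∣c (p∤c q pr)
    ... | inj₂ p∣z = p∣z

    cancel-c³ : ∀ z → + p ∣ℤ c³ * z → + p ∣ℤ z
    cancel-c³ z p∣ = cancel-c z (cancel-c (c₀ * z) (cancel-c (c₀ * (c₀ * z)) (subst (+ p ∣ℤ_) (reassoc c₀ z) p∣)))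
      where
      reassoc : ∀ c z → c * c * c * z ≡ c * (c * (c * z))
      reassoc = solve-∀

    -- The alternating sum of hhh vanishes, so G has to sum to zero modulo p.
    sum-hhh : ∀ X (G : List E → ℤ) → 3 ℕ.* suc q ℕ.< length X →
              (∀ A B → A ++ B ↭ X → + p ∣ℤ sign A * hhh (Σpt v A) - c³ * G A) →
              + p ∣ℤ splitSum X (λ A _ → G A)
    sum-hhh X G big ≈ = cancel-c³ _ (subst (+ p ∣ℤ_) (ℤ.neg-involutive _) (ℤ∣.∣m⇒∣-m
      (subst (+ p ∣ℤ_) (trans (cong₂ _-_ (alternating-sum v X hhh (D-hhh (length X) big) (0 , 0 , 0)) (splitSum-* X c³ (λ A _ → G A)))
        (ℤ.+-identityˡ _))
        (splitSum-congruent X (λ A _ → sign A * hhh (Σpt v A)) (λ A _ → c³ * G A) ≈))))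

    DivisibleNonempty : List E → Set
    DivisibleNonempty T = T ≢ [] × Divisible (Σpt v T)

    -- The Davenport constant of (ℤ/p)³ is at most 3p − 2.
    davenport : ∀ X → 3 ℕ.* suc q ℕ.< length X → Select DivisibleNonempty X
    davenport X big with select? {P = DivisibleNonempty}
      (λ { [] → no (λ z → proj₁ z refl)
         ; T@(_ ∷ _) → map′ (λ d → (λ ()) , d) proj₂ (zs? p (Σpt v T) ×-dec (p ℕ∣.∣? weight (Σpt v T))) })
      (λ {T} {T′} T↭T′ (T≢[] , d) → (λ { refl → T≢[] (↭-empty-inv T↭T′) }) , subst Divisible (Σpt-↭ v T↭T′) d) X
    ... | yes s = s
    -- Only the empty subsequence would contribute, so the sum would be 1 and not 0 modulo p.
    ... | no ¬s = contradiction (subst (+ p ∣ℤ_) (splitSum-empty X) (sum-hhh X empty big ≈)) (p∤1 pr)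
      where
      ≈ : ∀ A B → A ++ B ↭ X → + p ∣ℤ sign A * hhh (Σpt v A) - c³ * empty A
      ≈ [] B _ = subst (+ p ∣ℤ_) (units (hhh (0 , 0 , 0)) c³) (hhh-congruent (0 , 0 , 0) ((ℕ∣._∣0 p , ℕ∣._∣0 p) , ℕ∣._∣0 p))
        where
        units : ∀ x y → x - y ≡ 1ℤ * x - y * 1ℤ
        units = solve-∀
      ≈ A@(_ ∷ _) B A++B↭X = subst (+ p ∣ℤ_) (zeros (sign A * hhh (Σpt v A)) c³)
        (ℤ∣.∣n⇒∣m*n (sign A) (hhh-vanishes (Σpt v A) (λ d → ¬s (A , B , A++B↭X , (λ ()) , d))))
        where
        zeros : ∀ x y → x ≡ x - y * 0ℤ
        zeros = solve-∀

  unit : ∀ {E : Set} → (E → Point) → E → Point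
  unit v e = proj₁ (v e) , proj₁ (proj₂ (v e)) , 1

  weight-unit : ∀ {E : Set} (v : E → Point) A → weight (Σpt (unit v) A) ≡ length A
  weight-unit v []      = refl
  weight-unit v (_ ∷ A) = cong suc (weight-unit v A)

  ZS-unit : ∀ {E : Set} {n} (v w : E → Point) → (∀ e → proj₁ (v e) ≡ proj₁ (w e)) →
            (∀ e → proj₁ (proj₂ (v e)) ≡ proj₁ (proj₂ (w e))) → ∀ A → ZS n (Σpt v A) → ZS n (Σpt w A)
  ZS-unit {n = n} v w v≡w₁ v≡w₂ A (x , y) = subst (n ∣ℕ_) (first A) x , subst (n ∣ℕ_) (second A) y
    where
    first : ∀ A → proj₁ (Σpt v A) ≡ proj₁ (Σpt w A)
    first []      = refl
    first (e ∷ A) = cong₂ ℕ._+_ (v≡w₁ e) (first A)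
    second : ∀ A → proj₁ (proj₂ (Σpt v A)) ≡ proj₁ (proj₂ (Σpt w A))
    second []      = refl
    second (e ∷ A) = cong₂ ℕ._+_ (v≡w₂ e) (second A)

  -- The two statements for an arbitrary modulus

  ZSL : ∀ {E : Set} → (E → Point) → ℕ → ℕ → List E → Set
  ZSL v n k T = length T ≡ k × ZS n (Σpt v T)

  -- This is s_n((ℤ/n)²) ≤ 4n - 3, for sequences of length exactly 4n - 3 and without truncated
  -- subtraction. The type `E` of terms is arbitrary so that whole blocks can become the terms of a
  -- sequence modulo another factor of n.
  Kemnitz : ℕ → Set₁
  Kemnitz n = ∀ {E : Set} (v : E → Point) X → 4 ℕ.* n ≡ length X ℕ.+ 3 → Select (ZSL v n n) X

  OneOrTwo : ∀ {E : Set} → (E → Point) → ℕ → List E → Set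
  OneOrTwo v n T = ZS n (Σpt v T) × (weight (Σpt v T) ≡ n ⊎ weight (Σpt v T) ≡ n ℕ.+ n)

  -- The element y of weight 2 is what makes this statement multiplicative in n.
  Short : ℕ → Set₁
  Short n = ∀ {E : Set} (v : E → Point) y X → weight (v y) ≡ 1 ⊎ weight (v y) ≡ 2 →
            All (λ e → weight (v e) ≡ 1) X → 3 ℕ.* n ≡ length X ℕ.+ 3 → Select (OneOrTwo v n) (y ∷ X)

  splitAt : ∀ {E : Set} (X : List E) m k → length X ≡ m ℕ.+ k →
            ∃[ Y ] ∃[ Z ] (Y ++ Z ≡ X × length Y ≡ m × length Z ≡ k)
  splitAt X m k ≡m+k = take m X , drop m X , take++drop≡id m X ,
    trans (length-take m X) (ℕ.m≤n⇒m⊓n≡m (subst (m ℕ.≤_) (sym ≡m+k) (ℕ.m≤m+n m k))) ,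
    trans (length-drop m X) (trans (cong (ℕ._∸ m) ≡m+k) (ℕ.m+n∸m≡n m k))

  weight-ones : ∀ {E : Set} (v : E → Point) X → All (λ e → weight (v e) ≡ 1) X → weight (Σpt v X) ≡ length X
  weight-ones v []      []       = refl
  weight-ones v (x ∷ X) (w ∷ ws) = cong₂ ℕ._+_ w (weight-ones v X ws)

  -- The 3p - 2 terms contain a nonempty subsequence whose sum and weight are divisible by p. The
  -- total weight is at most (3p - 3) + 2 = 3p - 1, so this weight is p or 2p; there is just enough
  -- room for one term of weight 2.
  short-prime : ∀ {p} → Prime p → Short p
  short-prime {zero} pr = contradiction pr ¬prime[0]
  short-prime {suc zero} pr = contradiction pr ¬prime[1]
  short-prime {p@(suc (suc q))} pr v y X wy wX 3p≡ =
    let T , R , T++R↭ , T≢[] , zs , p∣w = PrimeCase.davenport q pr v (y ∷ X) big in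
    T , R , T++R↭ , zs , oneOrTwo T R T++R↭ T≢[] p∣w
    where
    big : 3 ℕ.* suc q ℕ.< length (y ∷ X)
    big = ℕ.s≤s (ℕ.≤-reflexive (ℕ.+-cancelʳ-≡ 3 _ _ (trans (shift3 q) 3p≡)))
      where
      shift3 : ∀ q → 3 ℕ.* (1 ℕ.+ q) ℕ.+ 3 ≡ 3 ℕ.* (2 ℕ.+ q)
      shift3 = ℕSolver.solve-∀
    positive : All (λ e → 0 ℕ.< weight (v e)) (y ∷ X)
    positive = Sum.[ pos , pos ]′ wy ∷ All.map pos wX
      where
      pos : ∀ {w k} → w ≡ suc k → 0 ℕ.< w
      pos refl = ℕ.s≤s ℕ.z≤n
    wy≤2 : weight (v y) ℕ.≤ 2
    wy≤2 = Sum.[ (λ e → subst (ℕ._≤ 2) (sym e) (ℕ.s≤s ℕ.z≤n)) , ℕ.≤-reflexive ]′ wy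
    oneOrTwo : ∀ T R → T ++ R ↭ y ∷ X → T ≢ [] → p ∣ℕ weight (Σpt v T) →
               weight (Σpt v T) ≡ p ⊎ weight (Σpt v T) ≡ p ℕ.+ p
    oneOrTwo [] R _ T≢[] _ = contradiction refl T≢[]
    oneOrTwo T@(t ∷ _) R T++R↭ _ (ℕ∣.divides j w≡) = cases j w≡
      where
      upper : weight (Σpt v T) ℕ.< 3 ℕ.* p
      upper = begin-strict
        weight (Σpt v T)                           ≤⟨ ℕ.m≤m+n _ (weight (Σpt v R)) ⟩
        weight (Σpt v T) ℕ.+ weight (Σpt v R)      ≡⟨ cong weight (Σpt-split v T R T++R↭) ⟨
        weight (v y) ℕ.+ weight (Σpt v X)          ≡⟨ cong (weight (v y) ℕ.+_) (weight-ones v X wX) ⟩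
        weight (v y) ℕ.+ length X                  ≤⟨ ℕ.+-monoˡ-≤ (length X) wy≤2 ⟩
        2 ℕ.+ length X                             <⟨ ℕ.n<1+n _ ⟩
        3 ℕ.+ length X                             ≡⟨ ℕ.+-comm 3 (length X) ⟩
        length X ℕ.+ 3                             ≡⟨ 3p≡ ⟨
        3 ℕ.* p ∎
        where open ℕ.≤-Reasoning
      lower : 0 ℕ.< weight (Σpt v T)
      lower = ℕ.<-≤-trans (All.head (All-resp-↭ (↭-sym T++R↭) positive)) (ℕ.m≤m+n (weight (v t)) _)
      cases : ∀ j → weight (Σpt v T) ≡ j ℕ.* p → weight (Σpt v T) ≡ p ⊎ weight (Σpt v T) ≡ p ℕ.+ p
      cases 0 w≡ = contradiction (subst (0 ℕ.<_) w≡ lower) λ ()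
      cases 1 w≡ = inj₁ (trans w≡ (ℕ.*-identityˡ p))
      cases 2 w≡ = inj₂ (trans w≡ (cong (p ℕ.+_) (ℕ.*-identityˡ p)))
      cases (suc (suc (suc j))) w≡ = contradiction (ℕ.*-cancelʳ-< p (3 ℕ.+ j) 3 (subst (ℕ._< 3 ℕ.* p) w≡ upper))
        (ℕ.≤⇒≯ (ℕ.s≤s (ℕ.s≤s (ℕ.s≤s ℕ.z≤n))))

  module _ {E : Set} (v : E → Point) where

    -- `Short` applies to the first 3n - 2 terms. If it yields 2n terms instead of n, the other n of
    -- the 3n terms have sum zero, because the whole sequence does.
    length-3n : ∀ n .{{_ : NonZero n}} → Short n → ∀ X → length X ≡ 3 ℕ.* n → ZS n (Σpt v X) → Select (ZSL v n n) X
    length-3n n@(suc m) short X ∣X∣≡3n zsX with splitAt X (suc (3 ℕ.* m)) 2 (trans ∣X∣≡3n (split m))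
      where
      split : ∀ m → 3 ℕ.* (1 ℕ.+ m) ≡ 1 ℕ.+ 3 ℕ.* m ℕ.+ 2
      split = ℕSolver.solve-∀
    ... | y ∷ Y , Z , refl , ∣Y∣ , ∣Z∣ = finish (short (unit v) y Y (inj₁ refl) (All.universal (λ _ → refl) Y)
            (trans (triple m) (cong (ℕ._+ 3) (sym (ℕ.suc-injective ∣Y∣)))))
      where
      triple : ∀ m → 3 ℕ.* (1 ℕ.+ m) ≡ 3 ℕ.* m ℕ.+ 3
      triple = ℕSolver.solve-∀
      finish : Select (OneOrTwo (unit v) n) (y ∷ Y) → Select (ZSL v n n) ((y ∷ Y) ++ Z)
      finish (T , R , T++R↭ , zsT , inj₁ w≡n) = Select-within (y ∷ Y) Z ↭-refl
        (T , R , T++R↭ , trans (sym (weight-unit v T)) w≡n , ZS-unit (unit v) v (λ _ → refl) (λ _ → refl) T zsT)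
      finish (T , R , T++R↭ , zsT , inj₂ w≡2n) =
        R ++ Z , T , ↭-trans (++-comm (R ++ Z) T) T++R++Z↭ ,
        ℕ.+-cancelˡ-≡ (length T) _ _ (trans (length-split T (R ++ Z) T++R++Z↭) (trans ∣X∣≡3n (trans (triple′ n)
          (cong (ℕ._+ n) (trans (sym w≡2n) (weight-unit v T)))))) ,
        ZS-cancelˡ (Σpt v T) (Σpt v (R ++ Z)) (subst (ZS n) (Σpt-split v T (R ++ Z) T++R++Z↭) zsX)
          (ZS-unit (unit v) v (λ _ → refl) (λ _ → refl) T zsT)
        where
        T++R++Z↭ : T ++ (R ++ Z) ↭ (y ∷ Y) ++ Z
        T++R++Z↭ = ↭-trans (↭-sym (++-assoc T R Z)) (++⁺ʳ Z T++R↭)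
        triple′ : ∀ n → 3 ℕ.* n ≡ n ℕ.+ n ℕ.+ n
        triple′ = ℕSolver.solve-∀

  -- Reiher's theorem for a prime modulus

  <4⇒ : ∀ {j} → j ℕ.< 4 → j ≡ 0 ⊎ j ≡ 1 ⊎ j ≡ 2 ⊎ j ≡ 3
  <4⇒ {0} _ = inj₁ refl
  <4⇒ {1} _ = inj₂ (inj₁ refl)
  <4⇒ {2} _ = inj₂ (inj₂ (inj₁ refl))
  <4⇒ {3} _ = inj₂ (inj₂ (inj₂ refl))
  <4⇒ {suc (suc (suc (suc _)))} (ℕ.s≤s (ℕ.s≤s (ℕ.s≤s (ℕ.s≤s ()))))

  empty-nonempty : ∀ {E : Set} (A : List E) → length A ≢ 0 → empty A ≡ 0ℤ
  empty-nonempty []      ≢0 = contradiction refl ≢0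
  empty-nonempty (_ ∷ _) _  = refl

  module OddPrimeCase (q₀ : ℕ) (pr : Prime (suc (suc (suc q₀)))) {E : Set} (v : E → Point) where

    private
      q p : ℕ
      q = suc q₀
      p = suc (suc q)

    pt : E → Point
    pt = unit v

    open PrimeCase q pr pt

    zsl? : ∀ k T → Dec (ZSL pt p k T)
    zsl? k T = (length T ℕ.≟ k) ×-dec zs? p (Σpt pt T)

    χ : ℕ → List E → ℤ
    χ k T = 𝟙 (zsl? k T)

    -- Reiher's count (k | X) of the zero-sum subsequences of length k, taken by position.
    N : ℕ → List E → ℤ
    N k X = splitSum X (λ A _ → χ k A)

    χ-length : ∀ k T → length T ≢ k → χ k T ≡ 0ℤ
    χ-length k T ≢k = 𝟙-no (zsl? k T) (≢k ∘ proj₁)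

    χ-ZS : ∀ k T → ¬ ZS p (Σpt pt T) → χ k T ≡ 0ℤ
    χ-ZS k T ¬zs = 𝟙-no (zsl? k T) (¬zs ∘ proj₂)

    χ-yes : ∀ k T → length T ≡ k → ZS p (Σpt pt T) → χ k T ≡ 1ℤ
    χ-yes k T ≡k zs = 𝟙-yes (zsl? k T) (≡k , zs)

    2∤p : ¬ (2 ∣ℕ p)
    2∤p 2∣p with prime⇒irreducible pr 2∣p
    ... | inj₁ ()
    ... | inj₂ ()

    2∣p+1 : 2 ∣ℕ suc p
    2∣p+1 = go p 2∤p
      where
      go : ∀ k → ¬ (2 ∣ℕ k) → 2 ∣ℕ suc k
      go zero 2∤0 = contradiction (2 ℕ∣.∣0) 2∤0
      go (suc zero) _ = ℕ∣.∣-refl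
      go (suc (suc k)) 2∤ = ℕ∣.∣m∣n⇒∣m+n (ℕ∣.∣-refl {2}) (go k (λ 2∣k → 2∤ (ℕ∣.∣m∣n⇒∣m+n (ℕ∣.∣-refl {2}) 2∣k)))

    2∣p-1 : 2 ∣ℕ suc q
    2∣p-1 = ℕ∣.∣m+n∣m⇒∣n {m = 2} 2∣p+1 ℕ∣.∣-refl

    2∣2p : 2 ∣ℕ 2 ℕ.* p
    2∣2p = ℕ∣.∣m⇒∣m*n p (ℕ∣.∣-refl {2})

    multiple-injective : ∀ i j → i ≢ j → i ℕ.* p ≢ j ℕ.* p
    multiple-injective i j i≢j ip≡jp = i≢j (ℕ.*-cancelʳ-≡ i j p ip≡jp)

    -- A has one of the lengths 0, p, 2p; the middle one is excluded by assumption.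
    p∣1+N₂ₚ : ∀ Y → 3 ℕ.* suc q ℕ.< length Y → length Y ℕ.< 3 ℕ.* p → ¬ Select (ZSL pt p p) Y →
              + p ∣ℤ 1ℤ + N (2 ℕ.* p) Y
    p∣1+N₂ₚ Y lower upper ¬s = subst (+ p ∣ℤ_)
      (trans (splitSum-+ Y (λ A _ → empty A) (λ A _ → χ (2 ℕ.* p) A)) (cong (_+ N (2 ℕ.* p) Y) (splitSum-empty Y)))
      (sum-hhh Y G lower ≈)
      where
      G : List E → ℤ
      G A = empty A + χ (2 ℕ.* p) A
      zero-value : ∀ A → ¬ Divisible (Σpt pt A) → + p ∣ℤ sign A * hhh (Σpt pt A) - c³ * G A
      zero-value A ¬div = subst (λ z → + p ∣ℤ sign A * hhh (Σpt pt A) - c³ * z) (sym G≡0)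
        (subst (+ p ∣ℤ_) (zeros (sign A * hhh (Σpt pt A)) c³)
          (ℤ∣.∣n⇒∣m*n (sign A) (hhh-vanishes (Σpt pt A) ¬div)))
        where
        zeros : ∀ x y → x ≡ x - y * 0ℤ
        zeros = solve-∀
        G≡0 : G A ≡ 0ℤ
        G≡0 = cong₂ _+_
          (empty-nonempty A (λ ≡0 → ¬div (subst (Divisible ∘ Σpt pt) (sym (length-0 A ≡0))
            ((p ℕ∣.∣0 , p ℕ∣.∣0) , p ℕ∣.∣0))))
          (𝟙-no (zsl? (2 ℕ.* p) A) (λ { (≡2p , zs) → ¬div (zs , ℕ∣.divides 2 (trans (weight-unit v A) ≡2p)) }))
          where
          length-0 : ∀ A → length A ≡ 0 → A ≡ []
          length-0 [] _ = refl
      one-value : ∀ A → Divisible (Σpt pt A) → sign A ≡ 1ℤ → G A ≡ 1ℤ →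
                  + p ∣ℤ sign A * hhh (Σpt pt A) - c³ * G A
      one-value A div s≡1 G≡1 = subst₂ (λ s z → + p ∣ℤ s * hhh (Σpt pt A) - c³ * z) (sym s≡1) (sym G≡1)
        (subst (+ p ∣ℤ_) (units (hhh (Σpt pt A)) c³) (hhh-congruent (Σpt pt A) div))
        where
        units : ∀ x y → x - y ≡ 1ℤ * x - y * 1ℤ
        units = solve-∀
      ≈ : ∀ A B → A ++ B ↭ Y → + p ∣ℤ sign A * hhh (Σpt pt A) - c³ * G A
      ≈ A B A++B↭Y with zs? p (Σpt pt A) ×-dec (p ℕ∣.∣? weight (Σpt pt A))
      ... | no ¬div = zero-value A ¬div
      ... | yes div@(zs , ℕ∣.divides j w≡) = cases j (trans (sym (weight-unit v A)) w≡)
        where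
        ∣A∣<3p : length A ℕ.< 3 ℕ.* p
        ∣A∣<3p = ℕ.≤-<-trans (subst (length A ℕ.≤_) (length-split A B A++B↭Y) (ℕ.m≤m+n (length A) (length B))) upper
        cases : ∀ j → length A ≡ j ℕ.* p → + p ∣ℤ sign A * hhh (Σpt pt A) - c³ * G A
        cases 0 ≡0 = one-value A div (sign-even A (subst (2 ∣ℕ_) (sym ≡0) (2 ℕ∣.∣0)))
          (cong₂ _+_ (length-0 A ≡0) (χ-length (2 ℕ.* p) A (λ ≡2p → multiple-injective 0 2 (λ ()) (trans (sym ≡0) ≡2p))))
          where
          length-0 : ∀ A → length A ≡ 0 → empty A ≡ 1ℤ
          length-0 [] _ = refl
        cases 1 ≡p = contradiction (A , B , A++B↭Y , trans ≡p (ℕ.*-identityˡ p) , zs) ¬s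
        cases 2 ≡2p = one-value A div (sign-even A (subst (2 ∣ℕ_) (sym ≡2p) 2∣2p))
          (cong₂ _+_ (empty-nonempty A (λ ≡0 → multiple-injective 0 2 (λ ()) (trans (sym ≡0) ≡2p)))
                     (χ-yes (2 ℕ.* p) A ≡2p zs))
        cases (suc (suc (suc j))) ≡jp = contradiction (ℕ.*-cancelʳ-< p (3 ℕ.+ j) 3 (subst (ℕ._< 3 ℕ.* p) ≡jp ∣A∣<3p))
          (ℕ.≤⇒≯ (ℕ.s≤s (ℕ.s≤s (ℕ.s≤s ℕ.z≤n))))

    p-1 3p-1 : ℕ
    p-1 = suc q
    3p-1 = 2 ℕ.* p ℕ.+ suc q

    suc-p-1 : suc p-1 ≡ 1 ℕ.* p
    suc-p-1 = sym (ℕ.*-identityˡ p)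

    suc-3p-1 : suc 3p-1 ≡ 3 ℕ.* p
    suc-3p-1 = eq q
      where
      eq : ∀ q → 1 ℕ.+ (2 ℕ.* (2 ℕ.+ q) ℕ.+ (1 ℕ.+ q)) ≡ 3 ℕ.* (2 ℕ.+ q)
      eq = ℕSolver.solve-∀

    2∣3p-1 : 2 ∣ℕ 3p-1
    2∣3p-1 = ℕ∣.∣m∣n⇒∣m+n 2∣2p 2∣p-1

    HH : Point → ℤ
    HH (a , b , w) = H q pr a b w

    -- The degrees are 2(p - 1) for the two `h`, p - 2 for `narrow` and p for `wide`. They add up to
    -- 4p - 4, just below the length 4p - 3 of the sequence.
    D-HH : ∀ d → 4 ℕ.* p ≡ d ℕ.+ 3 → D d HH
    D-HH d 4p≡ = D-* {3 ℕ.+ 2 ℕ.* q} {2 ℕ.+ 2 ℕ.* q ℕ.+ 1} d (λ x → h q pr (proj₁ x) * h q pr (proj₁ (proj₂ x)))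
      (λ x → Q q pr (weight x)) D-hh
      (D-* {suc q} {suc p} (2 ℕ.+ 2 ℕ.* q ℕ.+ 1) (λ x → narrow q pr (weight x)) (λ x → wide q pr (weight x))
        (D-rise weight (λ _ _ → refl) q (+ 2)) (D-rise weight (λ _ _ → refl) p (- + (2 ℕ.* p)))
        (ℕ.≤-reflexive (bound₁ q)))
      (ℕ.≤-reflexive (ℕ.+-cancelʳ-≡ 2 _ _ (trans (bound₂ q) (trans 4p≡ (ℕ.+-suc d 2)))))
      where
      bound₁ : ∀ q → (1 ℕ.+ q) ℕ.+ (3 ℕ.+ q) ≡ 1 ℕ.+ (2 ℕ.+ 2 ℕ.* q ℕ.+ 1)
      bound₁ = ℕSolver.solve-∀
      bound₂ : ∀ q → (3 ℕ.+ 2 ℕ.* q) ℕ.+ (2 ℕ.+ 2 ℕ.* q ℕ.+ 1) ℕ.+ 2 ≡ 4 ℕ.* (2 ℕ.+ q)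
      bound₂ = ℕSolver.solve-∀

    -- The values of the signed `HH` divided by p and by `C`. Length jp gives j - 2 and length jp -
    -- 1 gives 2 - j, so 0, p - 1 and 3p - 1 give -2, 1 and -1, while 2p and 2p - 1 give 0; that is
    -- why `wide` starts at k - 2p. The lengths p and 3p are excluded separately. The three
    -- surviving lengths are even for odd p, so their sign is 1.
    ρ : List E → ℤ
    ρ A = - + 2 * empty A + (χ p-1 A + -1ℤ * χ 3p-1 A)

    ρ-value : ∀ A {x y z} → empty A ≡ x → χ p-1 A ≡ y → χ 3p-1 A ≡ z → ρ A ≡ - + 2 * x + (y + -1ℤ * z)
    ρ-value A refl refl refl = refl

    splitSum-ρ : ∀ X → splitSum X (λ A _ → ρ A) ≡ - + 2 + (N p-1 X + -1ℤ * N 3p-1 X)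
    splitSum-ρ X = trans (splitSum-+ X _ _) (cong₂ _+_
      (trans (splitSum-* X (- + 2) (λ A _ → empty A)) (cong (- + 2 *_) (splitSum-empty X)))
      (trans (splitSum-+ X _ _) (cong (λ z → N p-1 X + z) (splitSum-* X -1ℤ (λ A _ → χ 3p-1 A)))))

    ∤-between : ∀ k j → k ≡ j ℕ.* p → ¬ (p ∣ℕ suc k)
    ∤-between k j k≡ p∣sk = p∤1 pr (∣ℕ⇒∣ℤ (ℕ∣.∣m+n∣m⇒∣n (subst (p ∣ℕ_) (ℕ.+-comm 1 k) p∣sk) (ℕ∣.divides j k≡)))

    ≢-p-1 : ∀ k j → k ≡ j ℕ.* p → k ≢ p-1
    ≢-p-1 k j k≡ k≡p-1 = ∤-between k j k≡ (ℕ∣.divides 1 (trans (cong suc k≡p-1) suc-p-1))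

    ≢-3p-1 : ∀ k j → k ≡ j ℕ.* p → k ≢ 3p-1
    ≢-3p-1 k j k≡ k≡3p-1 = ∤-between k j k≡ (ℕ∣.divides 3 (trans (cong suc k≡3p-1) suc-3p-1))

    module _ (X : List E) (4p≡ : 4 ℕ.* p ≡ length X ℕ.+ 3) (¬s : ¬ Select (ZSL pt p p) X) where

      -- At length 3p the polynomial takes the nonzero value j - 2 = 1, so this length has to be
      -- ruled out by other means.
      ¬s₃ : ¬ Select (ZSL pt p (3 ℕ.* p)) X
      ¬s₃ (T , R , T++R↭X , ≡3p , zs) = ¬s (Select-within T R T++R↭X (length-3n pt p (short-prime pr) T ≡3p zs))

      suc-length<4p : ∀ A B → A ++ B ↭ X → suc (length A) ℕ.< 4 ℕ.* p
      suc-length<4p A B A++B↭X = begin-strict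
        suc (length A)  ≤⟨ ℕ.s≤s (subst (length A ℕ.≤_) (length-split A B A++B↭X) (ℕ.m≤m+n (length A) (length B))) ⟩
        suc (length X)  <⟨ ℕ.m<n⇒m<1+n (ℕ.n<1+n _) ⟩
        3 ℕ.+ length X  ≡⟨ ℕ.+-comm 3 (length X) ⟩
        length X ℕ.+ 3  ≡⟨ 4p≡ ⟨
        4 ℕ.* p         ∎
        where open ℕ.≤-Reasoning

      Approx : List E → Set
      Approx A = + p * + p ∣ℤ sign A * HH (Σpt pt A) - + p * C q pr * ρ A

      approx-zero : ∀ A → + p * + p ∣ℤ HH (Σpt pt A) → ρ A ≡ 0ℤ → Approx A
      approx-zero A p²∣HH ρ≡0 = subst (λ z → + p * + p ∣ℤ sign A * HH (Σpt pt A) - + p * C q pr * z) (sym ρ≡0)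
        (subst (+ p * + p ∣ℤ_) (zeros (sign A * HH (Σpt pt A)) (+ p * C q pr)) (ℤ∣.∣n⇒∣m*n (sign A) p²∣HH))
        where
        zeros : ∀ x y → x ≡ x - y * 0ℤ
        zeros = solve-∀

      approx-even : ∀ A r → 2 ∣ℕ length A → + p * + p ∣ℤ HH (Σpt pt A) - + p * C q pr * r → ρ A ≡ r → Approx A
      approx-even A r 2∣k ≈ refl = subst (λ s → + p * + p ∣ℤ s * HH (Σpt pt A) - + p * C q pr * r) (sym (sign-even A 2∣k))
        (subst (λ z → + p * + p ∣ℤ z - + p * C q pr * r) (sym (ℤ.*-identityˡ (HH (Σpt pt A)))) ≈)

      approx : ∀ A B → A ++ B ↭ X → Approx A
      approx A B A++B↭X = by-sum (zs? p (Σpt pt A))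
        where
        by-sum : Dec (ZS p (Σpt pt A)) → Approx A
        by-sum (no ¬zs) = approx-zero A (H-nonzero-sum q pr (proj₁ (Σpt pt A)) (proj₁ (proj₂ (Σpt pt A))) (weight (Σpt pt A)) ¬zs)
            (ρ-value A (empty-nonempty A (λ ≡0 → ¬zs (ZS-length-0 A ≡0))) (χ-ZS p-1 A ¬zs) (χ-ZS 3p-1 A ¬zs))
            where
            ZS-length-0 : ∀ A → length A ≡ 0 → ZS p (Σpt pt A)
            ZS-length-0 [] _ = p ℕ∣.∣0 , p ℕ∣.∣0
        by-sum (yes zs@(p∣a , p∣b)) = by-length (p ℕ∣.∣? length A) (p ℕ∣.∣? suc (length A))
            where
            k≡ : weight (Σpt pt A) ≡ length A
            k≡ = weight-unit v A
            0-case : ∀ j → length A ≡ j ℕ.* p → + p * + p ∣ℤ HH (Σpt pt A) - + p * C q pr * (+ j - + 2)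
            0-case j ≡jp = H-0 q pr (proj₁ (Σpt pt A)) (proj₁ (proj₂ (Σpt pt A))) (weight (Σpt pt A)) j p∣a p∣b (trans k≡ ≡jp)
            -1-case : ∀ j → suc (length A) ≡ j ℕ.* p → + p * + p ∣ℤ HH (Σpt pt A) - + p * C q pr * (- (+ j - + 2))
            -1-case j ≡jp = H--1 q pr (proj₁ (Σpt pt A)) (proj₁ (proj₂ (Σpt pt A))) (weight (Σpt pt A)) j p∣a p∣b (trans (cong suc k≡) ≡jp)
            drop-zero : ∀ z → + p * + p ∣ℤ z - + p * C q pr * 0ℤ → + p * + p ∣ℤ z
            drop-zero z = subst (+ p * + p ∣ℤ_) (zeros z (+ p * C q pr))
              where
              zeros : ∀ x y → x - y * 0ℤ ≡ x
              zeros = solve-∀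
            nonempty : ∀ j → j ≢ 0 → length A ≡ j ℕ.* p → empty A ≡ 0ℤ
            nonempty j j≢0 ≡jp = empty-nonempty A (λ ≡0 → multiple-injective j 0 j≢0 (trans (sym ≡jp) ≡0))
            multiple : ∀ j → length A ≡ j ℕ.* p → j ℕ.< 4 → Approx A
            multiple j ≡jp j<4 with <4⇒ j<4
            ... | inj₁ refl = approx-even A (- + 2) (subst (2 ∣ℕ_) (sym ≡jp) (2 ℕ∣.∣0)) (0-case 0 ≡jp)
              (ρ-value A (empty-length-0 A ≡jp) (χ-length p-1 A (≢-p-1 _ 0 ≡jp)) (χ-length 3p-1 A (≢-3p-1 _ 0 ≡jp)))
              where
              empty-length-0 : ∀ A → length A ≡ 0 → empty A ≡ 1ℤ
              empty-length-0 [] _ = refl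
            ... | inj₂ (inj₁ refl) = contradiction (A , B , A++B↭X , trans ≡jp (ℕ.*-identityˡ p) , zs) ¬s
            ... | inj₂ (inj₂ (inj₁ refl)) = approx-zero A (drop-zero (HH (Σpt pt A)) (0-case 2 ≡jp))
              (ρ-value A (nonempty 2 (λ ()) ≡jp) (χ-length p-1 A (≢-p-1 _ 2 ≡jp)) (χ-length 3p-1 A (≢-3p-1 _ 2 ≡jp)))
            ... | inj₂ (inj₂ (inj₂ refl)) = contradiction (A , B , A++B↭X , ≡jp , zs) ¬s₃
            module _ (j : ℕ) (≡jp : suc (length A) ≡ j ℕ.* p) where
              len≢0 : length A ≢ 0
              len≢0 ≡0 = ∤-between 0 0 refl (ℕ∣.divides j (trans (cong suc (sym ≡0)) ≡jp))
              χ-p-1 : j ≢ 1 → χ p-1 A ≡ 0ℤ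
              χ-p-1 j≢1 = χ-length p-1 A (λ e → multiple-injective j 1 j≢1 (trans (sym ≡jp) (trans (cong suc e) suc-p-1)))
              χ-3p-1 : j ≢ 3 → χ 3p-1 A ≡ 0ℤ
              χ-3p-1 j≢3 = χ-length 3p-1 A (λ e → multiple-injective j 3 j≢3 (trans (sym ≡jp) (trans (cong suc e) suc-3p-1)))
            suc-multiple : ∀ j → suc (length A) ≡ j ℕ.* p → j ℕ.< 4 → Approx A
            suc-multiple j ≡jp j<4 with <4⇒ j<4
            ... | inj₁ refl = contradiction ≡jp λ ()
            ... | inj₂ (inj₁ refl) = approx-even A 1ℤ (subst (2 ∣ℕ_) (sym len) 2∣p-1) (-1-case 1 ≡jp)
              (ρ-value A (empty-nonempty A (len≢0 1 ≡jp)) (χ-yes p-1 A len zs) (χ-3p-1 1 ≡jp λ ()))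
              where
              len : length A ≡ p-1
              len = ℕ.suc-injective (trans ≡jp (sym suc-p-1))
            ... | inj₂ (inj₂ (inj₁ refl)) = approx-zero A (drop-zero (HH (Σpt pt A)) (-1-case 2 ≡jp))
              (ρ-value A (empty-nonempty A (len≢0 2 ≡jp)) (χ-p-1 2 ≡jp λ ()) (χ-3p-1 2 ≡jp λ ()))
            ... | inj₂ (inj₂ (inj₂ refl)) = approx-even A -1ℤ (subst (2 ∣ℕ_) (sym len) 2∣3p-1) (-1-case 3 ≡jp)
              (ρ-value A (empty-nonempty A (len≢0 3 ≡jp)) (χ-p-1 3 ≡jp λ ()) (χ-yes 3p-1 A len zs))
              where
              len : length A ≡ 3p-1
              len = ℕ.suc-injective (trans ≡jp (sym suc-3p-1))
            by-length : Dec (p ∣ℕ length A) → Dec (p ∣ℕ suc (length A)) → Approx A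
            by-length (yes (ℕ∣.divides j ≡jp)) _ = multiple j ≡jp
              (ℕ.*-cancelʳ-< p j 4 (subst (ℕ._< 4 ℕ.* p) ≡jp (ℕ.<-trans (ℕ.n<1+n _) (suc-length<4p A B A++B↭X))))
            by-length (no _) (yes (ℕ∣.divides j ≡jp)) = suc-multiple j ≡jp
              (ℕ.*-cancelʳ-< p j 4 (subst (ℕ._< 4 ℕ.* p) ≡jp (suc-length<4p A B A++B↭X)))
            by-length (no p∤k) (no p∤sk) = approx-zero A
              (H-other q pr (proj₁ (Σpt pt A)) (proj₁ (proj₂ (Σpt pt A))) (weight (Σpt pt A)) (p∤k ∘ subst (p ∣ℕ_) k≡) (p∤sk ∘ subst (p ∣ℕ_) (cong suc k≡)))
              (ρ-value A (empty-nonempty A (λ ≡0 → p∤k (subst (p ∣ℕ_) (sym ≡0) (p ℕ∣.∣0))))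
                (χ-length p-1 A (λ e → p∤sk (ℕ∣.divides 1 (trans (cong suc e) suc-p-1))))
                (χ-length 3p-1 A (λ e → p∤sk (ℕ∣.divides 3 (trans (cong suc e) suc-3p-1)))))

      -- The alternating sum of `HH` is 0, and modulo p² it equals p · C times this expression. One
      -- p cancels exactly, and C = c⁴ is a unit modulo p.
      p∣-2+N-N : + p ∣ℤ - + 2 + (N p-1 X + -1ℤ * N 3p-1 X)
      p∣-2+N-N = cancel-c Y (cancel-c³′ (ℤ∣.*-cancelˡ-∣ (+ p) {+ p} {C q pr * Y} p²∣))
        where
        Y = - + 2 + (N p-1 X + -1ℤ * N 3p-1 X)
        total : + p * + p ∣ℤ 0ℤ - + p * C q pr * Y
        total = subst (+ p * + p ∣ℤ_)
          (cong₂ _-_ (alternating-sum pt X HH (D-HH (length X) 4p≡) (0 , 0 , 0))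
            (trans (splitSum-* X (+ p * C q pr) (λ A _ → ρ A)) (cong (+ p * C q pr *_) (splitSum-ρ X))))
          (splitSum-congruent X (λ A _ → sign A * HH (Σpt pt A)) (λ A _ → + p * C q pr * ρ A) approx)
        p²∣ : + p * + p ∣ℤ + p * (C q pr * Y)
        p²∣ = subst (+ p * + p ∣ℤ_) (negate (+ p) (C q pr) Y) (ℤ∣.∣m⇒∣-m total)
          where
          negate : ∀ p c y → - (0ℤ - p * c * y) ≡ p * (c * y)
          negate = solve-∀
        cancel-c³′ : + p ∣ℤ C q pr * Y → + p ∣ℤ c q pr * Y
        cancel-c³′ p∣ = cancel-c³ (c q pr * Y) (subst (+ p ∣ℤ_) (reassoc (c q pr) Y) p∣)
          where
          reassoc : ∀ c y → c * c * (c * c) * y ≡ c * c * c * (c * y)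
          reassoc = solve-∀

      private
        2p : ℕ
        2p = 2 ℕ.* p

      expand : ∀ z Y → z * (1ℤ + N 2p Y) ≡ z + splitSum Y (λ C _ → z * χ 2p C)
      expand z Y = trans (distribute z (N 2p Y)) (cong (λ y → z + y) (sym (splitSum-* Y z (λ C _ → χ 2p C))))
        where
        distribute : ∀ z n → z * (1ℤ + n) ≡ z + z * n
        distribute = solve-∀

      p∣χ*[1+N] : ∀ k A Y → (length A ≡ k → + p ∣ℤ 1ℤ + N 2p Y) → + p ∣ℤ χ k A * (1ℤ + N 2p Y)
      p∣χ*[1+N] k A Y p∣1+N = by-length (length A ℕ.≟ k)
        where
        by-length : Dec (length A ≡ k) → + p ∣ℤ χ k A * (1ℤ + N 2p Y)
        by-length (yes ≡k) = ℤ∣.∣n⇒∣m*n (χ k A) (p∣1+N ≡k)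
        by-length (no ≢k) = subst (λ z → + p ∣ℤ z * (1ℤ + N 2p Y)) (sym (χ-length k A ≢k)) (divides 0ℤ refl)

      S₁ S₃ : ℤ
      S₁ = splitSum X (λ A B → splitSum B (λ C _ → χ p-1 A * χ 2p C))
      S₃ = splitSum X (λ U _ → splitSum U (λ C _ → χ 3p-1 U * χ 2p C))

      -- Outside a zero-sum `A` of length p - 1 there are 3p - 2 terms, and `p∣1+N₂ₚ` holds for
      -- them. Summation over `A` gives the claim.
      p∣N+S₁ : + p ∣ℤ N p-1 X + S₁
      p∣N+S₁ = subst (+ p ∣ℤ_)
        (trans (splitSum-cong X (λ A B _ → expand (χ p-1 A) B)) (splitSum-+ X (λ A _ → χ p-1 A) _))
        (splitSum-∣ X {F = λ A B → χ p-1 A * (1ℤ + N 2p B)} (λ A B A++B↭X → p∣χ*[1+N] p-1 A B (λ ≡p-1 →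
          let ∣B∣ = ∣B∣≡ A B A++B↭X ≡p-1 in
          p∣1+N₂ₚ B (ℕ.≤-reflexive (sym ∣B∣)) (ℕ.≤-trans (ℕ.s≤s (ℕ.≤-reflexive ∣B∣)) (ℕ.<⇒≤ (ℕ.≤-reflexive (bound q))))
            (¬s ∘ Select-within B A (↭-trans (++-comm B A) A++B↭X)))))
        where
        bound : ∀ q → 1 ℕ.+ (1 ℕ.+ (1 ℕ.+ 3 ℕ.* (1 ℕ.+ q))) ≡ 3 ℕ.* (2 ℕ.+ q)
        bound = ℕSolver.solve-∀
        ∣B∣≡ : ∀ A B → A ++ B ↭ X → length A ≡ p-1 → length B ≡ suc (3 ℕ.* suc q)
        ∣B∣≡ A B A++B↭X ≡p-1 = ℕ.+-cancelʳ-≡ 3 _ _ (ℕ.+-cancelˡ-≡ p-1 _ _ (begin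
          p-1 ℕ.+ (length B ℕ.+ 3)      ≡⟨ ℕ.+-assoc p-1 (length B) 3 ⟨
          p-1 ℕ.+ length B ℕ.+ 3        ≡⟨ cong (λ k → k ℕ.+ length B ℕ.+ 3) ≡p-1 ⟨
          length A ℕ.+ length B ℕ.+ 3   ≡⟨ cong (ℕ._+ 3) (length-split A B A++B↭X) ⟩
          length X ℕ.+ 3                ≡⟨ 4p≡ ⟨
          4 ℕ.* p                       ≡⟨ total q ⟩
          p-1 ℕ.+ (suc (3 ℕ.* suc q) ℕ.+ 3) ∎))
          where
          open ≡-Reasoning
          total : ∀ q → 4 ℕ.* (2 ℕ.+ q) ≡ (1 ℕ.+ q) ℕ.+ (1 ℕ.+ 3 ℕ.* (1 ℕ.+ q) ℕ.+ 3)
          total = ℕSolver.solve-∀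

      -- The same congruence is used inside a zero-sum `U` of length 3p - 1. The lengths 3p - 2 and
      -- 3p - 1 are exactly those that `p∣1+N₂ₚ` admits.
      p∣N+S₃ : + p ∣ℤ N 3p-1 X + S₃
      p∣N+S₃ = subst (+ p ∣ℤ_)
        (trans (splitSum-cong X (λ U _ _ → expand (χ 3p-1 U) U)) (splitSum-+ X (λ U _ → χ 3p-1 U) _))
        (splitSum-∣ X {F = λ U _ → χ 3p-1 U * (1ℤ + N 2p U)} (λ U R U++R↭X → p∣χ*[1+N] 3p-1 U U (λ ≡3p-1 →
          p∣1+N₂ₚ U (ℕ.≤-trans (ℕ.m≤n+m _ 1) (ℕ.≤-reflexive (trans (bound q) (sym ≡3p-1))))
            (ℕ.≤-reflexive (trans (cong suc ≡3p-1) suc-3p-1))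
            (¬s ∘ Select-within U R U++R↭X))))
        where
        bound : ∀ q → 1 ℕ.+ (1 ℕ.+ 3 ℕ.* (1 ℕ.+ q)) ≡ 2 ℕ.* (2 ℕ.+ q) ℕ.+ (1 ℕ.+ q)
        bound = ℕSolver.solve-∀

      -- Both sums count the pairs of disjoint zero-sum subsequences of lengths p − 1 and 2p.
      S₁≡S₃ : S₁ ≡ S₃
      S₁≡S₃ = trans (splitSum-assoc X (λ A C _ → χ p-1 A * χ 2p C))
        (splitSum-cong X (λ U _ _ → splitSum-cong U (λ C A C++A↭U → exchange U C A C++A↭U)))
        where
        -- Once `C` has length 2p and sum zero, `A` is zero-sum of length p - 1 precisely when `U`
        -- is zero-sum of length 3p - 1.
        exchange : ∀ U C A → C ++ A ↭ U → χ p-1 A * χ 2p C ≡ χ 3p-1 U * χ 2p C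
        exchange U C A C++A↭U = by-C (zsl? 2p C)
          where
          lengths : length C ℕ.+ length A ≡ length U
          lengths = length-split C A C++A↭U
          sums : Σpt pt U ≡ Σpt pt C ∙ Σpt pt A
          sums = Σpt-split pt C A C++A↭U
          by-A : ZSL pt p 2p C → Dec (ZSL pt p p-1 A) → χ p-1 A ≡ χ 3p-1 U
          by-A (∣C∣ , zsC) (yes (∣A∣ , zsA)) = trans (χ-yes p-1 A ∣A∣ zsA)
            (sym (χ-yes 3p-1 U (trans (sym lengths) (cong₂ ℕ._+_ ∣C∣ ∣A∣))
              (subst (ZS p) (sym sums) (ZS-∙ (Σpt pt C) (Σpt pt A) zsC zsA))))
          by-A (∣C∣ , zsC) (no ¬A) = trans (𝟙-no (zsl? p-1 A) ¬A)
            (sym (𝟙-no (zsl? 3p-1 U) (λ { (∣U∣ , zsU) → ¬A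
              ( ℕ.+-cancelˡ-≡ 2p _ _ (trans (cong (ℕ._+ length A) (sym ∣C∣)) (trans lengths ∣U∣))
              , ZS-cancelˡ (Σpt pt C) (Σpt pt A) (subst (ZS p) sums zsU) zsC) })))
          by-C : Dec (ZSL pt p 2p C) → χ p-1 A * χ 2p C ≡ χ 3p-1 U * χ 2p C
          by-C (yes C✓) = cong (_* χ 2p C) (by-A C✓ (zsl? p-1 A))
          by-C (no ¬C) = trans (cong (χ p-1 A *_) (𝟙-no (zsl? 2p C) ¬C))
            (trans (trans (ℤ.*-zeroʳ (χ p-1 A)) (sym (ℤ.*-zeroʳ (χ 3p-1 U))))
              (cong (χ 3p-1 U *_) (sym (𝟙-no (zsl? 2p C) ¬C))))

      -- With `S₁≡S₃`, the two divisibilities from the double counting make N(p - 1) - N(3p - 1)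
      -- vanish modulo p, whereas `p∣-2+N-N` makes it 2. Hence p would divide 2, but p ≥ 3.
      impossible : ⊥
      impossible = 2≢p (∣ℤ⇒∣ℕ p∣2)
        where
        combine : ∀ m n s → (m + s) - (n + s) - (- + 2 + (m + -1ℤ * n)) ≡ + 2
        combine = solve-∀
        p∣2 : + p ∣ℤ + 2
        p∣2 = subst (+ p ∣ℤ_)
          (trans (cong (λ s → N p-1 X + S₁ - (N 3p-1 X + s) - (- + 2 + (N p-1 X + -1ℤ * N 3p-1 X))) (sym S₁≡S₃))
            (combine (N p-1 X) (N 3p-1 X) S₁))
          (ℤ∣.∣m∣n⇒∣m-n (ℤ∣.∣m∣n⇒∣m-n p∣N+S₁ p∣N+S₃) p∣-2+N-N)
        2≢p : ¬ (p ∣ℕ 2)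
        2≢p p∣2 with ℕ∣.∣⇒≤ p∣2
        ... | ℕ.s≤s (ℕ.s≤s ())

    kemnitz : ∀ X → 4 ℕ.* p ≡ length X ℕ.+ 3 → Select (ZSL pt p p) X
    kemnitz X 4p≡ = by-search (select? (zsl? p)
      (λ T↭T′ (len , zs) → trans (sym (↭-length T↭T′)) len , subst (ZS p) (Σpt-↭ pt T↭T′) zs) X)
      where
      by-search : Dec (Select (ZSL pt p p) X) → Select (ZSL pt p p) X
      by-search (yes s) = s
      by-search (no ¬s) = ⊥-elim (impossible X 4p≡ ¬s)

  -- The prime 2, and all primes together

  select-pair : ∀ {E : Set} (X : List E) (i j : Fin (length X)) → i F.< j →
                ∃[ R ] (lookup X i ∷ lookup X j ∷ R ↭ X)
  select-pair (x ∷ X) F.zero (F.suc j) _ = let R , p = one X j in R , ↭-prep x p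
    where
    one : ∀ X j → ∃[ R ] (lookup X j ∷ R ↭ X)
    one (x ∷ X) F.zero = X , ↭-refl
    one (x ∷ X) (F.suc j) = let R , p = one X j in x ∷ R , ↭-trans (↭.swap _ x ↭-refl) (↭-prep x p)
  select-pair (x ∷ X) (F.suc i) (F.suc j) (ℕ.s≤s i<j) =
    let R , p = select-pair X i j i<j in x ∷ R , ↭-trans (shift x (lookup X i ∷ lookup X j ∷ []) R) (↭-prep x p)

  -- The signs in the odd case rely on p - 1 being even. For p = 2 there are five terms in four
  -- residue classes, and two terms of the same class have sum zero.
  kemnitz-2 : Kemnitz 2
  kemnitz-2 {E} v X 8≡ with F.pigeonhole {4} {length X} (subst (4 ℕ.<_) (ℕ.+-cancelʳ-≡ 3 5 _ 8≡) (ℕ.n<1+n 4)) (class ∘ lookup X)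
    where
    class : E → Fin 4
    class e = F.combine (proj₁ (v e) mod 2) (proj₁ (proj₂ (v e)) mod 2)
  ... | i , j , i<j , same = let R , p = select-pair X i j i<j in
    x ∷ y ∷ [] , R , p , refl ,
    even (proj₁ (v x)) (proj₁ (v y)) (proj₁ residues) , even (proj₁ (proj₂ (v x))) (proj₁ (proj₂ (v y))) (proj₂ residues)
    where
    x = lookup X i
    y = lookup X j
    residues = F.combine-injective (proj₁ (v x) mod 2) (proj₁ (proj₂ (v x)) mod 2)
                                   (proj₁ (v y) mod 2) (proj₁ (proj₂ (v y)) mod 2) same
    even : ∀ a b → a mod 2 ≡ b mod 2 → 2 ∣ℕ a ℕ.+ (b ℕ.+ 0)
    even a b a≡b = ℕ∣.m%n≡0⇒n∣m _ 2 (begin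
      (a ℕ.+ (b ℕ.+ 0)) % 2               ≡⟨ cong (λ z → (a ℕ.+ z) % 2) (ℕ.+-identityʳ b) ⟩
      (a ℕ.+ b) % 2                       ≡⟨ %-distribˡ-+ a b 2 ⟩
      (a % 2 ℕ.+ b % 2) % 2               ≡⟨ cong (λ z → (z ℕ.+ b % 2) % 2) rem ⟩
      (b % 2 ℕ.+ b % 2) % 2               ≡⟨ cong (_% 2) (double (b % 2)) ⟩
      (b % 2 ℕ.* 2) % 2                   ≡⟨ m*n%n≡0 (b % 2) 2 ⟩
      0                                   ∎)
      where
      open ≡-Reasoning
      double : ∀ m → m ℕ.+ m ≡ m ℕ.* 2
      double = ℕSolver.solve-∀
      rem : a % 2 ≡ b % 2
      rem = trans (sym (F.toℕ-fromℕ< (m%n<n a 2))) (trans (cong F.toℕ a≡b) (F.toℕ-fromℕ< (m%n<n b 2)))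

  kemnitz-prime : ∀ {p} → Prime p → Kemnitz p
  kemnitz-prime {0} pr = contradiction pr ¬prime[0]
  kemnitz-prime {1} pr = contradiction pr ¬prime[1]
  kemnitz-prime {2} pr = kemnitz-2
  kemnitz-prime {suc (suc (suc q₀))} pr v X 4p≡ =
    let T , R , p , len , zs = OddPrimeCase.kemnitz q₀ pr v X 4p≡ in
    T , R , p , len , ZS-unit (unit v) v (λ _ → refl) (λ _ → refl) T zs

open import Data.Nat using (ℕ; suc; _+_; _*_; _∸_; _≤_; _<_)
open import Data.Nat.Divisibility using (_∣_)
open import Relation.Nullary using (¬_)
open PrimeModulus

-- Composite moduli

Select-≤ : ∀ {n} .{{_ : NonZero n}} → Kemnitz n → ∀ {E : Set} (v : E → Point) X →
           4 * n ≤ length X + 3 → Select (ZSL v n n) X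
Select-≤ {n@(suc m)} kem v X 4n≤ with splitAt X (suc (4 * m)) (length X ∸ suc (4 * m)) (sym (ℕ.m+[n∸m]≡n enough))
  where
  shape : ∀ m → 4 * (1 + m) ≡ 1 + 4 * m + 3
  shape = ℕSolver.solve-∀
  enough : suc (4 * m) ≤ length X
  enough = ℕ.+-cancelʳ-≤ 3 _ _ (subst (_≤ length X + 3) (shape m) 4n≤)
... | Y , Z , refl , ∣Y∣ , _ = Select-within Y Z ↭-refl (kem v Y (trans (shape m) (cong (_+ 3) (sym ∣Y∣))))
  where
  shape : ∀ m → 4 * (1 + m) ≡ 1 + 4 * m + 3
  shape = ℕSolver.solve-∀

concat-↭ : ∀ {E : Set} {Bs Cs : List (List E)} → Bs ↭ Cs → concat Bs ↭ concat Cs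
concat-↭ ↭.refl = ↭-refl
concat-↭ (↭.prep B p) = ++⁺ˡ B (concat-↭ p)
concat-↭ (↭.swap B C p) = ↭-trans (shifts B C) (++⁺ˡ C (++⁺ˡ B (concat-↭ p)))
concat-↭ (↭.trans p r) = ↭-trans (concat-↭ p) (concat-↭ r)

length-concat : ∀ {E : Set} q (Bs : List (List E)) → All (λ B → length B ≡ q) Bs → length (concat Bs) ≡ length Bs * q
length-concat q []       []       = refl
length-concat q (B ∷ Bs) (e ∷ es) = trans (length-++ B) (cong₂ _+_ e (length-concat q Bs es))

-- Disjoint zero-sum blocks and their values as terms

module _ {E : Set} (v : E → Point) (q : ℕ) .{{_ : NonZero q}} where

  record Blocks (t : ℕ) (X : List E) (r : ℕ) : Set where
    field
      blocks      : List (List E)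
      rest        : List E
      blocks-rest : concat blocks ++ rest ↭ X
      count       : length blocks ≡ t
      zero-sum    : All (ZSL v q q) blocks
      length-rest : length rest ≡ r

  -- Blocks are removed greedily. Before the last removal q + r terms are left, and the condition on
  -- `r` says that these are at least 4q - 3.
  extract : Kemnitz q → ∀ t X r → length X ≡ t * q + r → 3 * q ≤ r + 3 → Blocks t X r
  extract kem zero X r ∣X∣ _ = record
    { blocks = [] ; rest = X ; blocks-rest = ↭-refl ; count = refl ; zero-sum = [] ; length-rest = ∣X∣ }
  extract kem (suc t) X r ∣X∣ 3q≤ = record
    { blocks = B ∷ blocks
    ; rest = rest
    ; blocks-rest = ↭-trans (++-assoc B (concat blocks) rest) (↭-trans (++⁺ˡ B blocks-rest) B++Y↭X)
    ; count = cong suc count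
    ; zero-sum = B✓ ∷ zero-sum
    ; length-rest = length-rest
    }
    where
    enough : 4 * q ≤ length X + 3
    enough = begin
      q + 3 * q                  ≤⟨ ℕ.+-mono-≤ (ℕ.m≤m+n q (t * q)) 3q≤ ⟩
      suc t * q + (r + 3)      ≡⟨ ℕ.+-assoc (suc t * q) r 3 ⟨
      suc t * q + r + 3        ≡⟨ cong (_+ 3) ∣X∣ ⟨
      length X + 3                 ∎
      where open ℕ.≤-Reasoning
    first : Select (ZSL v q q) X
    first = Select-≤ kem v X enough
    B Y : List E
    B = proj₁ first
    Y = proj₁ (proj₂ first)
    B++Y↭X : B ++ Y ↭ X
    B++Y↭X = proj₁ (proj₂ (proj₂ first))
    B✓ : ZSL v q q B
    B✓ = proj₂ (proj₂ (proj₂ first))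
    ∣Y∣ : length Y ≡ t * q + r
    ∣Y∣ = ℕ.+-cancelˡ-≡ q _ _ (begin
      q + length Y            ≡⟨ cong (_+ length Y) (proj₁ B✓) ⟨
      length B + length Y     ≡⟨ length-split B Y B++Y↭X ⟩
      length X                  ≡⟨ ∣X∣ ⟩
      q + t * q + r       ≡⟨ ℕ.+-assoc q (t * q) r ⟩
      q + (t * q + r)     ∎)
      where open ≡-Reasoning
    open Blocks (extract kem t Y r ∣Y∣ 3q≤)

  blockValue : List E → Point
  blockValue B = let a , b , w = Σpt v B in a / q , b / q , w / q

  module _ (π : Point → ℕ) (π-∙ : ∀ x y → π (x ∙ y) ≡ π x + π y) (π-0 : π (0 , 0 , 0) ≡ 0)
           (π-/ : ∀ B → π (blockValue B) ≡ π (Σpt v B) / q) where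

    -- Stated for one coordinate `π` at a time, because the division in `blockValue` is exact only
    -- in a coordinate divisible by q. The weight of a block is not always known to be.
    Σpt-concat : ∀ Bs → All (λ B → q ∣ π (Σpt v B)) Bs → π (Σpt v (concat Bs)) ≡ π (Σpt blockValue Bs) * q
    Σpt-concat [] [] = trans π-0 (cong (_* q) (sym π-0))
    Σpt-concat (B ∷ Bs) (q∣B ∷ q∣Bs) = begin
      π (Σpt v (B ++ concat Bs))                                     ≡⟨ cong π (Σpt-++ v B (concat Bs)) ⟩
      π (Σpt v B ∙ Σpt v (concat Bs))                                ≡⟨ π-∙ (Σpt v B) _ ⟩
      π (Σpt v B) + π (Σpt v (concat Bs))                          ≡⟨ cong₂ _+_ (sym (m/n*n≡m q∣B)) (Σpt-concat Bs q∣Bs) ⟩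
      π (Σpt v B) / q * q + π (Σpt blockValue Bs) * q         ≡⟨ ℕ.*-distribʳ-+ q (π (Σpt v B) / q) _ ⟨
      (π (Σpt v B) / q + π (Σpt blockValue Bs)) * q             ≡⟨ cong (λ z → (z + π (Σpt blockValue Bs)) * q) (π-/ B) ⟨
      (π (blockValue B) + π (Σpt blockValue Bs)) * q            ≡⟨ cong (_* q) (π-∙ (blockValue B) _) ⟨
      π (blockValue B ∙ Σpt blockValue Bs) * q                     ∎
      where open ≡-Reasoning

  ZS-concat : ∀ r Bs → All (ZS q ∘ Σpt v) Bs → ZS r (Σpt blockValue Bs) → ZS (q * r) (Σpt v (concat Bs))
  ZS-concat r Bs q∣Bs (r∣a , r∣b) =
    subst₂ _∣_ (ℕ.*-comm r q) (sym (Σpt-concat proj₁ (λ _ _ → refl) refl (λ _ → refl) Bs (All.map proj₁ q∣Bs)))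
      (ℕ∣.*-monoˡ-∣ q r∣a) ,
    subst₂ _∣_ (ℕ.*-comm r q) (sym (Σpt-concat (proj₁ ∘ proj₂) (λ _ _ → refl) refl (λ _ → refl) Bs (All.map proj₂ q∣Bs)))
      (ℕ∣.*-monoˡ-∣ q r∣b)

  select-blocks : ∀ {r} → Kemnitz r → ∀ Bs R X → concat Bs ++ R ↭ X → All (ZSL v q q) Bs →
                  4 * r ≡ length Bs + 3 → Select (ZSL v (q * r) (q * r)) X
  select-blocks {r} kem Bs R X Bs++R↭X Bs✓ 4r≡ =
    concat T , concat U ++ R ,
    ↭-trans (↭-sym (++-assoc (concat T) (concat U) R))
      (↭-trans (++⁺ʳ R (↭-trans (↭-reflexive (concat-++ T U)) (concat-↭ T++U↭Bs))) Bs++R↭X) ,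
    trans (length-concat q T (All.map proj₁ T✓)) (trans (cong (_* q) ∣T∣) (ℕ.*-comm r q)) ,
    ZS-concat r T (All.map proj₂ T✓) zsT
    where
    selected : Select (ZSL blockValue r r) Bs
    selected = kem blockValue Bs 4r≡
    T U : List (List E)
    T = proj₁ selected
    U = proj₁ (proj₂ selected)
    T++U↭Bs : T ++ U ↭ Bs
    T++U↭Bs = proj₁ (proj₂ (proj₂ selected))
    ∣T∣ : length T ≡ r
    ∣T∣ = proj₁ (proj₂ (proj₂ (proj₂ selected)))
    zsT : ZS r (Σpt blockValue T)
    zsT = proj₂ (proj₂ (proj₂ (proj₂ selected)))
    T✓ : All (ZSL v q q) T
    T✓ = ++⁻ˡ T (All-resp-↭ (↭-sym T++U↭Bs) Bs✓)

-- The classical reduction to primes: r blocks of length q whose values have sum zero modulo r form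
-- a zero-sum subsequence of length q r.
kemnitz-* : ∀ {q r} .{{_ : NonZero q}} .{{_ : NonZero r}} → Kemnitz q → Kemnitz r → Kemnitz (q * r)
kemnitz-* {q@(suc a)} {r@(suc b)} kem-q kem-r v X 4qr≡ =
  select-blocks v q kem-r blocks rest X blocks-rest zero-sum (trans (shape b) (cong (_+ 3) (sym count)))
  where
  shape : ∀ b → 4 * (1 + b) ≡ (1 + 4 * b) + 3
  shape = ℕSolver.solve-∀
  total : ∀ a b → 4 * ((1 + a) * (1 + b)) ≡ (1 + 4 * b) * (1 + a) + 3 * a + 3
  total = ℕSolver.solve-∀
  triple : ∀ a → 3 * (1 + a) ≡ 3 * a + 3
  triple = ℕSolver.solve-∀
  -- As 4qr - 3 = (4r - 3)q + (3q - 3), taking out 4r - 3 = 4b + 1 blocks leaves 3a terms, the least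
  -- remainder that `extract` allows.
  open Blocks (extract v q kem-q (suc (4 * b)) X (3 * a)
    (ℕ.+-cancelʳ-≡ 3 _ _ (trans (sym 4qr≡) (total a b))) (ℕ.≤-reflexive (triple a)))

-- As 3qr - 3 = (3r - 3)q + (3q - 3), there are 3r - 3 blocks of weight q, and the remaining terms
-- together with `y` are just enough for `Short q`. The subsequence `T₀` found there is the
-- distinguished term modulo r.
short-* : ∀ {q r} .{{_ : NonZero q}} .{{_ : NonZero r}} → Kemnitz q → Short q → Short r → Short (q * r)
short-* {q@(suc a)} {r@(suc b)} kem short-q short-r {E} v y X wy wX 3qr≡ =
  concat T , concat U ++ R ,
  ↭-trans (↭-sym (++-assoc (concat T) (concat U) R))
    (↭-trans (++⁺ʳ R (↭-trans (↭-reflexive (concat-++ T U)) (concat-↭ T++U↭)))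
      (↭-trans (++-assoc T₀ (concat blocks) R)
        (↭-trans (++⁺ˡ T₀ (++-comm (concat blocks) R))
          (↭-trans (↭-sym (++-assoc T₀ R (concat blocks)))
            (↭-trans (++⁺ʳ (concat blocks) T₀++R↭)
              (↭-prep y (↭-trans (++-comm rest (concat blocks)) blocks-rest))))))) ,
  ZS-concat v q r T (All.map proj₁ T✓) zsT ,
  Sum.map (λ e → trans weight-T (trans (cong (_* q) e) (ℕ.*-comm r q)))
          (λ e → trans weight-T (trans (cong (_* q) e) (double r q))) wT
  where
  total : ∀ a b → 3 * ((1 + a) * (1 + b)) ≡ (3 * b) * (1 + a) + 3 * a + 3
  total = ℕSolver.solve-∀
  triple : ∀ a → 3 * (1 + a) ≡ 3 * a + 3
  triple = ℕSolver.solve-∀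
  double : ∀ r q → (r + r) * q ≡ q * r + q * r
  double = ℕSolver.solve-∀
  open Blocks (extract v q kem (3 * b) X (3 * a)
    (ℕ.+-cancelʳ-≡ 3 _ _ (trans (sym 3qr≡) (total a b))) (ℕ.≤-reflexive (triple a)))
  ones : All (λ e → weight (v e) ≡ 1) (concat blocks ++ rest)
  ones = All-resp-↭ (↭-sym blocks-rest) wX
  selected₀ : Select (OneOrTwo v q) (y ∷ rest)
  selected₀ = short-q v y rest wy (++⁻ʳ (concat blocks) ones) (trans (triple a) (cong (_+ 3) (sym length-rest)))
  T₀ R : List E
  T₀ = proj₁ selected₀
  R = proj₁ (proj₂ selected₀)
  T₀++R↭ : T₀ ++ R ↭ y ∷ rest
  T₀++R↭ = proj₁ (proj₂ (proj₂ selected₀))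
  zsT₀ : ZS q (Σpt v T₀)
  zsT₀ = proj₁ (proj₂ (proj₂ (proj₂ selected₀)))
  wT₀ : weight (Σpt v T₀) ≡ q ⊎ weight (Σpt v T₀) ≡ q + q
  wT₀ = proj₂ (proj₂ (proj₂ (proj₂ selected₀)))
  weight-block : All (λ B → weight (Σpt v B) ≡ q) blocks
  weight-block = go blocks zero-sum (++⁻ˡ (concat blocks) ones)
    where
    go : ∀ Bs → All (ZSL v q q) Bs → All (λ e → weight (v e) ≡ 1) (concat Bs) → All (λ B → weight (Σpt v B) ≡ q) Bs
    go [] [] _ = []
    go (B ∷ Bs) ((∣B∣ , _) ∷ Bs✓) w = trans (weight-ones v B (++⁻ˡ B w)) ∣B∣ ∷ go Bs Bs✓ (++⁻ʳ B w)
  -- The weight q or 2q of `T₀` becomes 1 or 2 after division by q, as required of the first term;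
  -- the blocks have weight 1.
  selected : Select (OneOrTwo (blockValue v q) r) (T₀ ∷ blocks)
  selected = short-r (blockValue v q) T₀ blocks
    (Sum.map (λ e → trans (cong (_/ q) e) (n/n≡1 q))
             (λ e → trans (cong (_/ q) (trans e (cong (q +_) (sym (ℕ.+-identityʳ q))))) (m*n/n≡m 2 q)) wT₀)
    (All.map (λ e → trans (cong (_/ q) e) (n/n≡1 q)) weight-block)
    (trans (triple b) (cong (_+ 3) (sym count)))
  T U : List (List E)
  T = proj₁ selected
  U = proj₁ (proj₂ selected)
  T++U↭ : T ++ U ↭ T₀ ∷ blocks
  T++U↭ = proj₁ (proj₂ (proj₂ selected))
  zsT : ZS r (Σpt (blockValue v q) T)
  zsT = proj₁ (proj₂ (proj₂ (proj₂ selected)))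
  wT : weight (Σpt (blockValue v q) T) ≡ r ⊎ weight (Σpt (blockValue v q) T) ≡ r + r
  wT = proj₂ (proj₂ (proj₂ (proj₂ selected)))
  q∣weight : weight (Σpt v T₀) ≡ q ⊎ weight (Σpt v T₀) ≡ q + q → q ∣ weight (Σpt v T₀)
  q∣weight (inj₁ e) = ℕ∣.∣-reflexive (sym e)
  q∣weight (inj₂ e) = subst (q ∣_) (sym e) (ℕ∣.∣m∣n⇒∣m+n ℕ∣.∣-refl ℕ∣.∣-refl)
  T✓ : All (λ B → ZS q (Σpt v B) × q ∣ weight (Σpt v B)) T
  T✓ = ++⁻ˡ T (All-resp-↭ (↭-sym T++U↭)
    ((zsT₀ , q∣weight wT₀) ∷ All.zip (All.map proj₂ zero-sum , All.map (λ e → ℕ∣.∣-reflexive (sym e)) weight-block)))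
  weight-T : weight (Σpt v (concat T)) ≡ weight (Σpt (blockValue v q) T) * q
  weight-T = Σpt-concat v q weight (λ _ _ → refl) refl (λ _ → refl) T (All.map proj₂ T✓)

kemnitz-1 : Kemnitz 1
kemnitz-1 v (x ∷ []) _ = x ∷ [] , [] , ↭-refl , refl , ℕ∣.1∣ _ , ℕ∣.1∣ _
kemnitz-1 v (_ ∷ _ ∷ X) 4≡ = contradiction (ℕ.+-cancelʳ-≡ 3 1 (2 + length X) 4≡) λ ()

short-1 : Short 1
short-1 v y [] wy [] _ =
  y ∷ [] , [] , ↭-refl , (ℕ∣.1∣ _ , ℕ∣.1∣ _) , Sum.map (trans (ℕ.+-identityʳ _)) (trans (ℕ.+-identityʳ _)) wy
short-1 v y (x ∷ X) wy wX 3≡ = contradiction (ℕ.+-cancelʳ-≡ 3 0 (1 + length X) 3≡) λ ()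

kemnitz-short : ∀ n .{{_ : NonZero n}} → Kemnitz n × Short n
kemnitz-short n = let open PrimeFactorisation (factorise n) in
  subst Kemnitz (sym isFactorisation) (proj₁ (go factors factorsPrime)) ,
  subst Short (sym isFactorisation) (proj₂ (go factors factorsPrime))
  where
  go : ∀ ps → All Prime ps → Kemnitz (product ps) × Short (product ps)
  go []       []         = kemnitz-1 , short-1
  go (p ∷ ps) (pr ∷ prs) = kemnitz-* (kemnitz-prime pr) (proj₁ (go ps prs)) ,
                           short-* (kemnitz-prime pr) (short-prime pr) (proj₂ (go ps prs))
    where
    instance
      p≢0 : NonZero p
      p≢0 = prime⇒nonZero pr
      ps≢0 : NonZero (product ps)
      ps≢0 = productOfPrimes≢0 prs

-- With n = j r, the sequence splits into 4r − 4 blocks of length j and a zero-sum remainder of length 3j.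
zero-sum-select : ∀ j r .{{_ : NonZero j}} .{{_ : NonZero r}} {E : Set} (v : E → Point) X →
                  ZS (j * r) (Σpt v X) → length X + j ≡ 4 * (j * r) → Select (ZSL v (j * r) (j * r)) X
zero-sum-select j r@(suc b) {E} v X zsX ∣X∣ =
  select-blocks v j (proj₁ (kemnitz-short r)) (T ∷ blocks) R X
    (↭-trans (++⁺ʳ R (++-comm T (concat blocks)))
      (↭-trans (++-assoc (concat blocks) T R) (↭-trans (++⁺ˡ (concat blocks) T++R↭) blocks-rest)))
    (T✓ ∷ zero-sum) (trans (shape b) (cong (_+ 3) (cong suc (sym count))))
  where
  shape : ∀ b → 4 * (1 + b) ≡ (1 + 4 * b) + 3
  shape = ℕSolver.solve-∀
  total : ∀ j b → 4 * (j * (1 + b)) ≡ 4 * b * j + 3 * j + j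
  total = ℕSolver.solve-∀
  open Blocks (extract v j (proj₁ (kemnitz-short j)) (4 * b) X (3 * j)
    (ℕ.+-cancelʳ-≡ j _ _ (trans ∣X∣ (total j b))) (ℕ.m≤m+n (3 * j) 3))
  -- With modulus 1 on the block values, `ZS-concat` says just that the concatenated blocks have sum
  -- zero modulo j.
  zs-blocks : ZS j (Σpt v (concat blocks))
  zs-blocks = subst (λ n → ZS n (Σpt v (concat blocks))) (ℕ.*-identityʳ j)
    (ZS-concat v j 1 blocks (All.map proj₂ zero-sum) (ℕ∣.1∣ _ , ℕ∣.1∣ _))
  zs-rest : ZS j (Σpt v rest)
  zs-rest = ZS-cancelˡ (Σpt v (concat blocks)) (Σpt v rest)
    (subst (ZS j) (Σpt-split v (concat blocks) rest blocks-rest)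
      (ℕ∣.∣-trans (ℕ∣.m∣m*n r) (proj₁ zsX) , ℕ∣.∣-trans (ℕ∣.m∣m*n r) (proj₂ zsX))) zs-blocks
  last : Select (ZSL v j j) rest
  last = length-3n v j (proj₂ (kemnitz-short j)) rest length-rest zs-rest
  T R : List E
  T = proj₁ last
  R = proj₁ (proj₂ last)
  T++R↭ : T ++ R ↭ rest
  T++R↭ = proj₁ (proj₂ (proj₂ last))
  T✓ : ZSL v j j T
  T✓ = proj₂ (proj₂ (proj₂ last))

-- The two bounds

module _ {m : ℕ} where

  private
    n : ℕ
    n = suc m

  val : ZnSq n → Point
  val (a , b) = toℕ a , toℕ b , 0

  toℕ-mod : ∀ k → toℕ (k mod n) ≡ k % n
  toℕ-mod k = F.toℕ-fromℕ< (m%n<n k n)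

  toℕ-+ₙ : ∀ (a b : Fin n) k → toℕ b ≡ k % n → toℕ (a +ₙ b) ≡ (toℕ a + k) % n
  toℕ-+ₙ a b k b≡ = trans (toℕ-mod (toℕ a + toℕ b)) (begin
    (toℕ a + toℕ b) % n             ≡⟨ cong (λ z → (toℕ a + z) % n) b≡ ⟩
    (toℕ a + k % n) % n             ≡⟨ %-distribˡ-+ (toℕ a) (k % n) n ⟩
    (toℕ a % n + k % n % n) % n     ≡⟨ cong (λ z → (toℕ a % n + z) % n) (m%n%n≡m%n k n) ⟩
    (toℕ a % n + k % n) % n         ≡⟨ %-distribˡ-+ (toℕ a) k n ⟨
    (toℕ a + k) % n                 ∎)
    where open ≡-Reasoning

  toℕ-σ : ∀ (S : List (ZnSq n)) → toℕ (proj₁ (σ S)) ≡ proj₁ (Σpt val S) % n ×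
                                  toℕ (proj₂ (σ S)) ≡ proj₁ (proj₂ (Σpt val S)) % n
  toℕ-σ [] = toℕ-mod 0 , toℕ-mod 0
  toℕ-σ (x ∷ S) = toℕ-+ₙ (proj₁ x) _ _ (proj₁ (toℕ-σ S)) , toℕ-+ₙ (proj₂ x) _ _ (proj₂ (toℕ-σ S))

  ZeroSum⇒ZS : ∀ S → ZeroSum S → ZS n (Σpt val S)
  ZeroSum⇒ZS S zs =
    ℕ∣.m%n≡0⇒n∣m _ n (trans (sym (proj₁ (toℕ-σ S))) (trans (cong (toℕ ∘ proj₁) zs) (toℕ-mod 0))) ,
    ℕ∣.m%n≡0⇒n∣m _ n (trans (sym (proj₂ (toℕ-σ S))) (trans (cong (toℕ ∘ proj₂) zs) (toℕ-mod 0)))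

  ZS⇒ZeroSum : ∀ S → ZS n (Σpt val S) → ZeroSum S
  ZS⇒ZeroSum S (n∣a , n∣b) = cong₂ _,_
    (F.toℕ-injective (trans (proj₁ (toℕ-σ S)) (trans (ℕ∣.n∣m⇒m%n≡0 _ n n∣a) (sym (toℕ-mod 0)))))
    (F.toℕ-injective (trans (proj₂ (toℕ-σ S)) (trans (ℕ∣.n∣m⇒m%n≡0 _ n n∣b) (sym (toℕ-mod 0)))))

  Select⇒subsequence : ∀ S → Select (ZSL val n n) S → HasZeroSumSubseqOfLength n S
  Select⇒subsequence S (T , R , T++R↭S , ∣T∣ , zsT) =
    let T′ , T′⊆S , T′↭T = ↭⇒⊆ {T = T} {R} T++R↭S in
    T′ , T′⊆S , trans (↭-length T′↭T) ∣T∣ , ZS⇒ZeroSum T′ (subst (ZS n) (sym (Σpt-↭ val T′↭T)) zsT)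

  -- For a sequence shorter than 4n - 3, the deficit j = 4n - |S| satisfies 4 ≤ j < ℓ, so the
  -- minimality of ℓ makes j a divisor of n.
  upper-bound : ∀ ℓ → 4 ≤ ℓ → (∀ j → 4 ≤ j → j < ℓ → j ∣ n) → SkProp n n (4 * n ∸ ℓ + 1)
  upper-bound ℓ 4≤ℓ divisors S zsS long = Select⇒subsequence S (by-length (4 * n ℕ.≤? length S + 3))
    where
    by-length : Dec (4 * n ≤ length S + 3) → Select (ZSL val n n) S
    by-length (yes 4n≤) = Select-≤ (proj₁ (kemnitz-short n)) val S 4n≤
    by-length (no 4n≰) = by-divisor (divisors j 4≤j j<ℓ)
      where
      j : ℕ
      j = 4 * n ∸ length S
      ∣S∣+3<4n : length S + 3 < 4 * n
      ∣S∣+3<4n = ℕ.≰⇒> 4n≰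
      ∣S∣≤4n : length S ≤ 4 * n
      ∣S∣≤4n = ℕ.≤-trans (ℕ.m≤m+n (length S) 3) (ℕ.<⇒≤ ∣S∣+3<4n)
      ∣S∣+j≡4n : length S + j ≡ 4 * n
      ∣S∣+j≡4n = ℕ.m+[n∸m]≡n ∣S∣≤4n
      4≤j : 4 ≤ j
      4≤j = ℕ.+-cancelˡ-≤ (length S) 4 j (subst₂ _≤_ (sym (ℕ.+-suc (length S) 3)) (sym ∣S∣+j≡4n) ∣S∣+3<4n)
      j<ℓ : j < ℓ
      j<ℓ = ℕ.≰⇒> (λ ℓ≤j → ℕ.<⇒≱ (subst (_≤ length S) (ℕ.+-comm (4 * n ∸ ℓ) 1) long)
        (ℕ.m+n≤o⇒m≤o∸n (length S) (ℕ.≤-trans (ℕ.+-monoʳ-≤ (length S) ℓ≤j) (ℕ.≤-reflexive ∣S∣+j≡4n))))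
      by-divisor : j ∣ n → Select (ZSL val n n) S
      by-divisor (ℕ∣.divides r n≡rj) = subst (λ k → Select (ZSL val k k) S) jr≡n
        (zero-sum-select j r {{ℕ.>-nonZero (ℕ.≤-trans (ℕ.s≤s ℕ.z≤n) 4≤j)}} {{r≢0}} val S
          (subst (λ k → ZS k (Σpt val S)) (sym jr≡n) (ZeroSum⇒ZS S zsS))
          (trans ∣S∣+j≡4n (cong (4 *_) (sym jr≡n))))
        where
        jr≡n : j * r ≡ n
        jr≡n = trans (ℕ.*-comm j r) (sym n≡rj)
        r≢0 : NonZero r
        r≢0 = ℕ.≢-nonZero (λ { refl → contradiction n≡rj λ () })

  -- Sequences supported on a translated unit square

  element : ℕ → ℕ → ZnSq n
  element x y = x mod n , y mod n

  -- The nesting and the final 0 are those of the coordinate sums over `square`, which ends in the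
  -- empty list.
  weighted : ℕ → ℕ → ℕ → ℕ → ℕ → ℕ → ℕ → ℕ → ℕ
  weighted a b c d x y z w = a * x + (b * y + (c * z + (d * w + 0)))

  weighted-% : ∀ a b c d x y z w →
    weighted a b c d x y z w ≡
    weighted a b c d (x / n) (y / n) (z / n) (w / n) * n + weighted a b c d (x % n) (y % n) (z % n) (w % n)
  weighted-% a b c d x y z w = trans
    (cong₂ (λ x (y , z , w) → weighted a b c d x y z w) (m≡m%n+[m/n]*n x n)
      (cong₂ _,_ (m≡m%n+[m/n]*n y n) (cong₂ _,_ (m≡m%n+[m/n]*n z n) (m≡m%n+[m/n]*n w n))))
    (regroup a b c d (x % n) (y % n) (z % n) (w % n) (x / n) (y / n) (z / n) (w / n) n)
    where
    regroup : ∀ a b c d x y z w x′ y′ z′ w′ n →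
      a * (x + x′ * n) + (b * (y + y′ * n) + (c * (z + z′ * n) + (d * (w + w′ * n) + 0))) ≡
      (a * x′ + (b * y′ + (c * z′ + (d * w′ + 0)))) * n ℕ.+
      (a * x + (b * y + (c * z + (d * w + 0))))
    regroup = ℕSolver.solve-∀

  ∣-weighted : ∀ a b c d x y z w → n ∣ weighted a b c d x y z w →
               n ∣ weighted a b c d (x % n) (y % n) (z % n) (w % n)
  ∣-weighted a b c d x y z w n∣ = ℕ∣.∣m+n∣m⇒∣n (subst (n ∣_) (weighted-% a b c d x y z w) n∣)
    (ℕ∣.n∣m*n (weighted a b c d (x / n) (y / n) (z / n) (w / n)))

  ∣-weighted⁻¹ : ∀ a b c d x y z w → n ∣ weighted a b c d (x % n) (y % n) (z % n) (w % n) →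
                 n ∣ weighted a b c d x y z w
  ∣-weighted⁻¹ a b c d x y z w n∣ =
    subst (n ∣_) (sym (weighted-% a b c d x y z w)) (ℕ∣.∣m∣n⇒∣m+n
    (ℕ∣.n∣m*n (weighted a b c d (x / n) (y / n) (z / n) (w / n))) n∣)

  ⊆-replicate : ∀ k (e : ZnSq n) {Y T} → T ⊆ replicate k e ++ Y →
                ∃[ k′ ] ∃[ T′ ] (k′ ≤ k × T ≡ replicate k′ e ++ T′ × T′ ⊆ Y)
  ⊆-replicate zero    e τ = 0 , _ , ℕ.z≤n , refl , τ
  ⊆-replicate (suc k) e (_ ∷ʳ τ) = let k′ , T′ , k′≤k , T≡ , τ′ = ⊆-replicate k e τ in
    k′ , T′ , ℕ.m≤n⇒m≤1+n k′≤k , T≡ , τ′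
  ⊆-replicate (suc k) e (refl ∷ τ) = let k′ , T′ , k′≤k , T≡ , τ′ = ⊆-replicate k e τ in
    suc k′ , T′ , ℕ.s≤s k′≤k , cong (e ∷_) T≡ , τ′

  n∣-≤ : ∀ k → n ∣ k → k ≤ n → k ≡ 0 ⊎ k ≡ n
  n∣-≤ zero    _   _   = inj₁ refl
  n∣-≤ (suc k) n∣k k≤n = inj₂ (ℕ.≤-antisym k≤n (ℕ∣.∣⇒≤ n∣k))

  n∣-≤m : ∀ k → n ∣ k → k ≤ m → k ≡ 0
  n∣-≤m zero    _   _   = refl
  n∣-≤m (suc k) n∣k k≤m = contradiction (ℕ∣.∣⇒≤ n∣k) (ℕ.<⇒≱ (ℕ.s≤s k≤m))

  module _ (t : ℕ) where

    square : ℕ → ℕ → ℕ → ℕ → List (ZnSq n)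
    square a b c d = replicate a (element t t) ++ replicate b (element (suc t) t) ++
                     replicate c (element t (suc t)) ++ replicate d (element (suc t) (suc t)) ++ []

    length-square : ∀ a b c d → length (square a b c d) ≡ a + (b + (c + (d + 0)))
    length-square a b c d = step a (step b (step c (step d refl)))
      where
      step : ∀ k {e : ZnSq n} {Y r} → length Y ≡ r → length (replicate k e ++ Y) ≡ k + r
      step k {e} ≡r = trans (length-++ (replicate k e)) (cong₂ _+_ (length-replicate k) ≡r)

    Σ-replicate : (π : Point → ℕ) → (∀ x y → π (x ∙ y) ≡ π x + π y) → ∀ k e Y {x r} →
                  π (val e) ≡ x → π (Σpt val Y) ≡ r → π (Σpt val (replicate k e ++ Y)) ≡ k * x + r
    Σ-replicate π π-∙ zero    e Y refl refl = refl
    Σ-replicate π π-∙ (suc k) e Y refl refl = trans (π-∙ (val e) _)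
      (trans (cong (π (val e) +_) (Σ-replicate π π-∙ k e Y refl refl)) (sym (ℕ.+-assoc (π (val e)) _ _)))

    Σ-square : ∀ a b c d → ZS n (Σpt val (square a b c d)) ⇔
      (n ∣ weighted a b c d t (suc t) t (suc t) × n ∣ weighted a b c d t t (suc t) (suc t))
    Σ-square a b c d = mk⇔
      (λ (x , y) → ∣-weighted⁻¹ a b c d t (suc t) t (suc t) (subst (n ∣_) first x) ,
                   ∣-weighted⁻¹ a b c d t t (suc t) (suc t) (subst (n ∣_) second y))
      (λ (x , y) → subst (n ∣_) (sym first) (∣-weighted a b c d t (suc t) t (suc t) x) ,
                   subst (n ∣_) (sym second) (∣-weighted a b c d t t (suc t) (suc t) y))
      where
      first : proj₁ (Σpt val (square a b c d)) ≡ weighted a b c d (t % n) (suc t % n) (t % n) (suc t % n)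
      first = let step = Σ-replicate proj₁ (λ _ _ → refl) in
        step a _ _ (toℕ-mod t) (step b _ _ (toℕ-mod (suc t)) (step c _ _ (toℕ-mod t) (step d _ [] (toℕ-mod (suc t)) refl)))
      second : proj₁ (proj₂ (Σpt val (square a b c d))) ≡ weighted a b c d (t % n) (t % n) (suc t % n) (suc t % n)
      second = let step = Σ-replicate (proj₁ ∘ proj₂) (λ _ _ → refl) in
        step a _ _ (toℕ-mod t) (step b _ _ (toℕ-mod t) (step c _ _ (toℕ-mod (suc t)) (step d _ [] (toℕ-mod (suc t)) refl)))

    ⊆-square : ∀ a b c d {T} → T ⊆ square a b c d →
      ∃[ a′ ] ∃[ b′ ] ∃[ c′ ] ∃[ d′ ] ((a′ ≤ a × b′ ≤ b × c′ ≤ c × d′ ≤ d) × T ≡ square a′ b′ c′ d′)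
    ⊆-square a b c d τ with ⊆-replicate a _ τ
    ... | a′ , _ , a′≤a , refl , τ₁ with ⊆-replicate b _ τ₁
    ... | b′ , _ , b′≤b , refl , τ₂ with ⊆-replicate c _ τ₂
    ... | c′ , _ , c′≤c , refl , τ₃ with ⊆-replicate d _ τ₃
    ... | d′ , _ , d′≤d , refl , [] = a′ , b′ , c′ , d′ , (a′≤a , b′≤b , c′≤c , d′≤d) , refl

    -- For n terms the translation contributes n t ≡ 0, so n divides both b + d and c + d. Either b
    -- + d = 0, and then c = 0 and a = n; or b + d = n, and then a = c = d = 0 and b = n. Both
    -- exceed the bound m = n - 1.
    no-zero-sum : ∀ a b c d → a ≤ m → b ≤ m → c ≤ m → d ≤ m →
                  a + (b + (c + (d + 0))) ≡ n → ¬ ZS n (Σpt val (square a b c d))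
    no-zero-sum a b c d a≤m b≤m c≤m d≤m total zs = by-size (n∣-≤ (b + d) n∣b+d b+d≤n)
      where
      both = Equivalence.to (Σ-square a b c d) zs
      n∣b+d : n ∣ b + d
      n∣b+d = ℕ∣.∣m+n∣m⇒∣n (subst (n ∣_) (trans (split a b c d t) (cong (λ k → k * t + (b + d)) total)) (proj₁ both))
        (ℕ∣.m∣m*n t)
        where
        split : ∀ a b c d t → a * t + (b * (1 + t) + (c * t + (d * (1 + t) + 0))) ≡
                              (a + (b + (c + (d + 0)))) * t + (b + d)
        split = ℕSolver.solve-∀
      n∣c+d : n ∣ c + d
      n∣c+d = ℕ∣.∣m+n∣m⇒∣n (subst (n ∣_) (trans (split a b c d t) (cong (λ k → k * t + (c + d)) total)) (proj₂ both))
        (ℕ∣.m∣m*n t)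
        where
        split : ∀ a b c d t → a * t + (b * t + (c * (1 + t) + (d * (1 + t) + 0))) ≡
                              (a + (b + (c + (d + 0)))) * t + (c + d)
        split = ℕSolver.solve-∀
      total′ : a + c + (b + d) ≡ n
      total′ = trans (regroup a b c d) total
        where
        regroup : ∀ a b c d → a + c + (b + d) ≡ a + (b + (c + (d + 0)))
        regroup = ℕSolver.solve-∀
      b+d≤n : b + d ≤ n
      b+d≤n = subst (b + d ≤_) total′ (ℕ.m≤n+m (b + d) (a + c))
      m≢n : ∀ {k} → k ≤ m → k ≢ n
      m≢n k≤m refl = ℕ.1+n≰n k≤m
      by-size : b + d ≡ 0 ⊎ b + d ≡ n → ⊥
      by-size (inj₁ b+d≡0) = m≢n a≤m (trans (sym (ℕ.+-identityʳ a)) (trans (cong (a +_) (sym c≡0)) a+c≡n))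
        where
        d≡0 : d ≡ 0
        d≡0 = ℕ.m+n≡0⇒n≡0 b b+d≡0
        c≡0 : c ≡ 0
        c≡0 = n∣-≤m c (subst (n ∣_) (trans (cong (c +_) d≡0) (ℕ.+-identityʳ c)) n∣c+d) c≤m
        a+c≡n : a + c ≡ n
        a+c≡n = trans (sym (ℕ.+-identityʳ (a + c))) (trans (cong (a + c +_) (sym b+d≡0)) total′)
      by-size (inj₂ b+d≡n) = m≢n b≤m (trans (sym (ℕ.+-identityʳ b)) (trans (cong (b +_) (sym d≡0)) b+d≡n))
        where
        c≡0 : c ≡ 0
        c≡0 = ℕ.m+n≡0⇒n≡0 a (ℕ.+-cancelʳ-≡ n (a + c) 0 (trans (cong (a + c +_) (sym b+d≡n)) total′))
        d≡0 : d ≡ 0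
        d≡0 = n∣-≤m d (subst (n ∣_) (cong (_+ d) c≡0) n∣c+d) d≤m

    no-subsequence : ∀ a b c d → a ≤ m → b ≤ m → c ≤ m → d ≤ m →
                     ¬ HasZeroSumSubseqOfLength n (square a b c d)
    no-subsequence a b c d a≤m b≤m c≤m d≤m (T , T⊆S , ∣T∣ , zsT) with ⊆-square a b c d T⊆S
    ... | a′ , b′ , c′ , d′ , (a′≤a , b′≤b , c′≤c , d′≤d) , refl =
      no-zero-sum a′ b′ c′ d′ (ℕ.≤-trans a′≤a a≤m) (ℕ.≤-trans b′≤b b≤m) (ℕ.≤-trans c′≤c c≤m) (ℕ.≤-trans d′≤d d≤m)
        (trans (sym (length-square a′ b′ c′ d′)) ∣T∣) (ZeroSum⇒ZS (square a′ b′ c′ d′) zsT)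

  -- The translation and the multiplicities of the extremal sequence

  bézout-solution : ∀ N e z → gcd N n ∣ e → z + e ≡ 2 * n → ∃[ t ] n ∣ N * t + z
  bézout-solution N e z (ℕ∣.divides k e≡kg) z+e≡2n = by-identity (Bézout.identity (gcd-GCD N n))
    where
    g : ℕ
    g = gcd N n
    z+kg≡2n : z + k * g ≡ 2 * n
    z+kg≡2n = trans (cong (z +_) (sym e≡kg)) z+e≡2n
    by-identity : Bézout.Identity.Identity g N n → ∃[ t ] n ∣ N * t + z
    by-identity (Bézout.Identity.+- x y g+yn≡xN) = x * k , ℕ∣.divides (2 + k * y) (begin
      N * (x * k) + z              ≡⟨ rearrange₁ N x k z ⟩
      k * (x * N) + z              ≡⟨ cong (λ u → k * u + z) g+yn≡xN ⟨
      k * (g + y * n) + z        ≡⟨ rearrange₂ k g y n z ⟩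
      (z + k * g) + k * y * n  ≡⟨ cong (_+ k * y * n) z+kg≡2n ⟩
      2 * n + k * y * n          ≡⟨ ℕ.*-distribʳ-+ n 2 (k * y) ⟨
      (2 + k * y) * n              ∎)
      where
      open ≡-Reasoning
      rearrange₁ : ∀ N x k z → N * (x * k) + z ≡ k * (x * N) + z
      rearrange₁ = ℕSolver.solve-∀
      rearrange₂ : ∀ k g y n z → k * (g + y * n) + z ≡ (z + k * g) + k * y * n
      rearrange₂ = ℕSolver.solve-∀
    -- Here x N ≡ -g modulo n, and the factor m = n - 1 acts as -1. The multiple k g n of n is added
    -- to the left side to avoid subtraction.
    by-identity (Bézout.Identity.-+ x y g+xN≡yn) = x * k * m ,
      ℕ∣.∣m+n∣m⇒∣n {m = k * g * n} (ℕ∣.divides (2 + k * m * y) (begin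
        k * g * n + (N * (x * k * m) + z)   ≡⟨ rearrange₁ k g m N x z ⟩
        (z + k * g) + k * m * (g + x * N)   ≡⟨ cong₂ (λ u w → u + k * m * w) z+kg≡2n g+xN≡yn ⟩
        2 * n + k * m * (y * n)                 ≡⟨ rearrange₂ n k m y ⟩
        (2 + k * m * y) * n                       ∎)) (ℕ∣.n∣m*n (k * g))
      where
      open ≡-Reasoning
      rearrange₁ : ∀ k g m N x z → k * g * (1 + m) + (N * (x * k * m) + z) ≡
                                   (z + k * g) + k * m * (g + x * N)
      rearrange₁ = ℕSolver.solve-∀
      rearrange₂ : ∀ n k m y → 2 * n + k * m * (y * n) ≡ (2 + k * m * y) * n
      rearrange₂ = ℕSolver.solve-∀

  -- Otherwise n + 3, which is at least 4, would be among the divisors of n. The bound keeps the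
  -- subtraction that defines the first multiplicity of `extremal` from truncating.
  ℓ≤n+3 : ∀ ℓ → (∀ j → 4 ≤ j → j < ℓ → j ∣ n) → ℓ ≤ n + 3
  ℓ≤n+3 ℓ divisors = ℕ.≮⇒≥ (λ n+3<ℓ → ℕ.<⇒≱ (ℕ.m<m+n n (ℕ.s≤s ℕ.z≤n))
    (ℕ∣.∣⇒≤ (divisors (n + 3) (ℕ.+-monoˡ-≤ 3 (ℕ.s≤s ℕ.z≤n)) n+3<ℓ)))

  -- The gcd g divides n and ℓ, and g ≠ ℓ because ℓ ∤ n, so 2g ≤ ℓ. For g ≥ 2 the choice e = g
  -- works, since g + 2 ≤ 2g; for g = 1 the choice e = 2 works, since ℓ ≥ 4.
  choose-e : ∀ ℓ N → 4 ≤ ℓ → ¬ (ℓ ∣ n) → N + ℓ ≡ 4 * n →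
             ∃[ e ] (2 ≤ e × e + 2 ≤ ℓ × e ≤ n + 1 × gcd N n ∣ e)
  choose-e ℓ N 4≤ℓ ℓ∤n N+ℓ≡4n = by-g (gcd N n) refl
    where
    g∣ℓ : gcd N n ∣ ℓ
    g∣ℓ = ℕ∣.∣m+n∣m⇒∣n (subst (gcd N n ∣_) (sym N+ℓ≡4n) (ℕ∣.∣n⇒∣m*n 4 (gcd[m,n]∣n N n))) (gcd[m,n]∣m N n)
    g+g≤ℓ : ∀ g → g ∣ ℓ → g ≢ ℓ → g + g ≤ ℓ
    g+g≤ℓ g (ℕ∣.divides 0 refl) _ = contradiction 4≤ℓ λ ()
    g+g≤ℓ g (ℕ∣.divides 1 ℓ≡g) g≢ℓ = contradiction (trans (sym (ℕ.*-identityˡ g)) (sym ℓ≡g)) g≢ℓ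
    g+g≤ℓ g (ℕ∣.divides (suc (suc k)) refl) _ = ℕ.+-monoʳ-≤ g (ℕ.m≤m+n g (k * g))
    by-g : ∀ g → gcd N n ≡ g → ∃[ e ] (2 ≤ e × e + 2 ≤ ℓ × e ≤ n + 1 × gcd N n ∣ e)
    by-g 0 g≡ = contradiction (ℕ∣.0∣⇒≡0 (subst (_∣ n) g≡ (gcd[m,n]∣n N n))) λ ()
    by-g 1 g≡ = 2 , ℕ.≤-refl , 4≤ℓ , ℕ.+-monoˡ-≤ 1 (ℕ.s≤s ℕ.z≤n) , subst (_∣ 2) (sym g≡) (ℕ∣.1∣ 2)
    by-g g@(suc (suc _)) g≡ = g , 2≤g ,
      ℕ.≤-trans (ℕ.+-monoʳ-≤ g 2≤g) (g+g≤ℓ g (subst (_∣ ℓ) g≡ g∣ℓ) (λ { refl → ℓ∤n g∣n })) ,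
      ℕ.≤-trans (ℕ∣.∣⇒≤ g∣n) (ℕ.m≤m+n n 1) , ℕ∣.∣-reflexive g≡
      where
      2≤g : 2 ≤ g
      2≤g = ℕ.s≤s (ℕ.s≤s ℕ.z≤n)
      g∣n : g ∣ n
      g∣n = subst (_∣ n) g≡ (gcd[m,n]∣n N n)

  -- The multiplicities are chosen so that some translate of the square has sum zero.
  extremal : ∀ ℓ → 4 ≤ ℓ → ¬ (ℓ ∣ n) → ℓ ≤ n + 3 →
             ∃[ S ] (ZeroSum S × length S ≡ 4 * n ∸ ℓ × ¬ HasZeroSumSubseqOfLength n S)
  extremal ℓ 4≤ℓ ℓ∤n ℓ≤n+3 =
    square t a m m d ,
    ZS⇒ZeroSum (square t a m m d) (Equivalence.from (Σ-square t a m m d)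
      (subst (n ∣_) (sym (trans (split₁ a m d t) (cong (λ k → k * t + (m + d)) total))) n∣ ,
       subst (n ∣_) (sym (trans (split₂ a m d t) (cong (λ k → k * t + (m + d)) total))) n∣)) ,
    trans (length-square t a m m d) total ,
    no-subsequence t a m m d a≤m ℕ.≤-refl ℕ.≤-refl d≤m
    where
    N : ℕ
    N = 4 * n ∸ ℓ
    ℓ≤4n : ℓ ≤ 4 * n
    ℓ≤4n = ℕ.≤-trans ℓ≤n+3 (ℕ.+-monoʳ-≤ n (ℕ.*-monoʳ-≤ 3 {1} {n} (ℕ.s≤s ℕ.z≤n)))
    N+ℓ≡4n : N + ℓ ≡ 4 * n
    N+ℓ≡4n = ℕ.m∸n+n≡m ℓ≤4n
    chosen = choose-e ℓ N 4≤ℓ ℓ∤n N+ℓ≡4n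
    e a d : ℕ
    e = proj₁ chosen
    -- Two multiplicities are n - 1, so the other two must add up to 2n + 2 - ℓ, and `e` distributes
    -- this amount: a ≤ n - 1 means e ≤ ℓ - 2, and d ≤ n - 1 means e ≥ 2. Either coordinate of the
    -- total is then N t + (2n - e), which explains the condition that gcd(N, n) divides e.
    a = n + 1 + e ∸ ℓ
    d = n + 1 ∸ e
    2≤e : 2 ≤ e
    2≤e = proj₁ (proj₂ chosen)
    e+2≤ℓ : e + 2 ≤ ℓ
    e+2≤ℓ = proj₁ (proj₂ (proj₂ chosen))
    e≤n+1 : e ≤ n + 1
    e≤n+1 = proj₁ (proj₂ (proj₂ (proj₂ chosen)))
    d+e≡n+1 : d + e ≡ n + 1
    d+e≡n+1 = ℕ.m∸n+n≡m e≤n+1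
    a+ℓ≡n+1+e : a + ℓ ≡ n + 1 + e
    a+ℓ≡n+1+e = ℕ.m∸n+n≡m (ℕ.≤-trans ℓ≤n+3 (subst (_≤ n + 1 + e) (ℕ.+-assoc n 1 2) (ℕ.+-monoʳ-≤ (n + 1) 2≤e)))
    a≤m : a ≤ m
    a≤m = ℕ.+-cancelʳ-≤ (e + 2) a m (ℕ.≤-trans (ℕ.+-monoʳ-≤ a e+2≤ℓ) (ℕ.≤-reflexive (trans a+ℓ≡n+1+e (move m e))))
      where
      move : ∀ m e → 1 + m + 1 + e ≡ m + (e + 2)
      move = ℕSolver.solve-∀
    d≤m : d ≤ m
    d≤m = ℕ.+-cancelʳ-≤ 2 d m (ℕ.≤-trans (ℕ.+-monoʳ-≤ d 2≤e) (ℕ.≤-reflexive (trans d+e≡n+1 (move m))))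
      where
      move : ∀ m → 1 + m + 1 ≡ m + 2
      move = ℕSolver.solve-∀
    total : a + (m + (m + (d + 0))) ≡ N
    total = ℕ.+-cancelʳ-≡ (ℓ + e) _ N (begin
      a + (m + (m + (d + 0))) + (ℓ + e)    ≡⟨ regroup a m d ℓ e ⟩
      (a + ℓ) + (d + e) + (m + m)            ≡⟨ cong₂ (λ x y → x + y + (m + m)) a+ℓ≡n+1+e d+e≡n+1 ⟩
      (n + 1 + e) + (n + 1) + (m + m)      ≡⟨ collect m e ⟩
      4 * n + e                                    ≡⟨ cong (_+ e) N+ℓ≡4n ⟨
      N + ℓ + e                                    ≡⟨ ℕ.+-assoc N ℓ e ⟩
      N + (ℓ + e)                                  ∎)
      where
      open ≡-Reasoning
      regroup : ∀ a m d ℓ e → a + (m + (m + (d + 0))) + (ℓ + e) ≡ (a + ℓ) + (d + e) + (m + m)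
      regroup = ℕSolver.solve-∀
      collect : ∀ m e → (1 + m + 1 + e) + (1 + m + 1) + (m + m) ≡ 4 * (1 + m) + e
      collect = ℕSolver.solve-∀
    solution = bézout-solution N e (m + d) (proj₂ (proj₂ (proj₂ (proj₂ chosen))))
      (trans (ℕ.+-assoc m d e) (trans (cong (m +_) d+e≡n+1) (twice m)))
      where
      twice : ∀ m → m + (1 + m + 1) ≡ 2 * (1 + m)
      twice = ℕSolver.solve-∀
    t : ℕ
    t = proj₁ solution
    n∣ : n ∣ N * t + (m + d)
    n∣ = proj₂ solution
    split₁ : ∀ a m d t → a * t + (m * (1 + t) + (m * t + (d * (1 + t) + 0))) ≡
                         (a + (m + (m + (d + 0)))) * t + (m + d)
    split₁ = ℕSolver.solve-∀
    split₂ : ∀ a m d t → a * t + (m * t + (m * (1 + t) + (d * (1 + t) + 0))) ≡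
                         (a + (m + (m + (d + 0)))) * t + (m + d)
    split₂ = ℕSolver.solve-∀

theorem1p4 : (m ℓ : ℕ) → 4 ≤ ℓ → ¬ (ℓ ∣ suc m) → (∀ j → 4 ≤ j → j < ℓ → j ∣ suc m)
    → SkPrimeEq (suc m) (suc m) (4 * suc m ∸ ℓ + 1)
theorem1p4 m ℓ 4≤ℓ ℓ∤n divisors = upper-bound ℓ 4≤ℓ divisors , λ L sk →
  let S , zsS , ∣S∣ , none = extremal ℓ 4≤ℓ ℓ∤n (ℓ≤n+3 ℓ divisors) in
  subst (_≤ L) (ℕ.+-comm 1 (4 * suc m ∸ ℓ))
    (ℕ.≰⇒> (λ L≤ → none (sk S zsS (ℕ.≤-trans L≤ (ℕ.≤-reflexive (sym ∣S∣))))))
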